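{- Let $n\ge 1$ and $w\in S_n$. Then $w$ is spherical if and only if $w$ avoids each of the following twenty one patterns in $S_5$: \[ P=\{24531,25314,25341,34512,34521,35412,35421,42531,45123,45213,45231,45312,52314,52341,53124,53142,53412,53421,54123,54213,54231\}. \]
   Context: $S_n$ is the symmetric group, viewed as a Coxeter group with simple generators $I=\{s_1,\dots,s_{n-1}\}$, $s_i=(i\ i+1)$. The length $\ell(w)$ is the length of a shortest expression of $w$ in the $s_i$; such a shortest expression is a reduced word. The (left) descent set of $w$ is $J(w)=\{s_i : \ell(s_iw)<\ell(w)\}=\{s_i: w^{ -1}(i+1)<w^{ -1}(i)\}$. For $J\subseteq I$, $w_0(J)$ denotes the unique element of maximum length in the subgroup generated by $J$. The Dynkin diagram is the path graph on $I$ with $s_i$ adjacent to $s_{i+1}$. A permutation $w\in S_n$ is \emph{spherical} if it has a reduced word $s_{i_1}\cdots s_{i_{\ell(w)}}$ such that (S.1) for every $s_j\in I\setminus J(w)$, $|\{t: s_{i_t}=s_j\}|\le 1$; and (S.2) for every connected component $C$ of the induced subgraph of the Dynkin diagram on $J(w)$, $|\{t : s_{i_t}\in C\}|\le \ell(w_0(C))+|C|$. Pattern avoidance: writing $w=w_1\dots w_n$ in one-line notation, $w$ contains $p\in S_k$ if there are positions $i_1<\dots<i_k$ with $w_{i_1}\dots w_{i_k}$ in the same relative order as $p_1\dots p_k$; otherwise $w$ avoids $p$. -}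

module Defs where

open import Data.Nat using (ℕ; zero; suc; _+_; _∸_; _≤_; _<_; _≟_; _≤?_; pred)
open import Data.Fin using (Fin; toℕ) renaming (_<_ to _<ᶠ_)
open import Data.Vec using (Vec; _∷_; []; lookup; tabulate; map)
open import Data.List using (List; length; filter; foldr) renaming (_∷_ to _∷ₗ_; [] to []ₗ)
open import Data.List.Relation.Unary.All using (All)
open import Data.Product using (Σ; ∃; ∃-syntax; _×_; _,_)
open import Data.Bool using (if_then_else_)
open import Relation.Nullary using (¬_; _×-dec_)
open import Relation.Nullary.Decidable using (⌊_⌋)
open import Relation.Binary.PropositionalEquality using (_≡_)
open import Data.Fin.Permutation using (Permutation′; _⟨$⟩ʳ_)
open import Function.Bundles using (_⇔_)

-- Permutations in one-line notation: w = w₁ … wₙ with values in {1,…,n}.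
OneLine : ℕ → Set
OneLine n = Vec ℕ n

oneLine : ∀ {n} → Permutation′ n → OneLine n
oneLine π = tabulate (λ i → suc (toℕ (π ⟨$⟩ʳ i)))

idV : (n : ℕ) → OneLine n
idV n = tabulate (λ i → suc (toℕ i))

swapVal : ℕ → ℕ → ℕ
swapVal i x = if ⌊ x ≟ i ⌋ then suc i else (if ⌊ x ≟ suc i ⌋ then i else x)

-- a word is a list of indices i (standing for s_i)
Word : Set
Word = List ℕ

ValidWord : ℕ → Word → Set
ValidWord n ws = All (λ i → 1 ≤ i × i < n) ws

-- product s_{i1} s_{i2} ⋯ s_{ik} as a composition of functions (s_{i1} applied last),
-- in one-line notation; left multiplication by s_i swaps the values i and i+1.
prod : (n : ℕ) → Word → OneLine n
prod n ws = foldr (λ i v → map (swapVal i) v) (idV n) ws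

Expresses : (n : ℕ) → Word → OneLine n → Set
Expresses n ws w = ValidWord n ws × prod n ws ≡ w

IsLength : (n : ℕ) → OneLine n → ℕ → Set
IsLength n w m =
  (∃[ ws ] (Expresses n ws w × length ws ≡ m)) ×
  (∀ ws → Expresses n ws w → m ≤ length ws)

Reduced : (n : ℕ) → Word → OneLine n → Set
Reduced n ws w = Expresses n ws w × (∀ ws' → Expresses n ws' w → length ws ≤ length ws')

-- left descent set: s_i ∈ J(w) iff w⁻¹(i+1) < w⁻¹(i)
InJ : (n : ℕ) → OneLine n → ℕ → Set
InJ n w i = 1 ≤ i × i < n ×
  Σ (Fin n) λ a → Σ (Fin n) λ b → lookup w a ≡ suc i × lookup w b ≡ i × a <ᶠ b

-- {s_a,…,s_b} is a connected component of the induced subgraph of the path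
-- Dynkin diagram on J(w): a maximal interval of consecutive descents.
IsComponent : (n : ℕ) → OneLine n → ℕ → ℕ → Set
IsComponent n w a b = a ≤ b × (∀ i → a ≤ i → i ≤ b → InJ n w i) ×
  ¬ InJ n w (pred a) × ¬ InJ n w (suc b)

countEq : ℕ → Word → ℕ
countEq j ws = length (filter (λ i → i ≟ j) ws)

countIn : ℕ → ℕ → Word → ℕ
countIn a b ws = length (filter (λ i → (a ≤? i) ×-dec (i ≤? b)) ws)

InParabolic : (n : ℕ) → ℕ → ℕ → OneLine n → Set
InParabolic n a b u = ∃[ ws ] (All (λ i → a ≤ i × i ≤ b) ws × Expresses n ws u)

IsLongest : (n : ℕ) → ℕ → ℕ → OneLine n → Set
IsLongest n a b u = InParabolic n a b u ×
  (∀ v → InParabolic n a b v → ∀ lv lu → IsLength n v lv → IsLength n u lu → lv ≤ lu)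

S1 : (n : ℕ) → OneLine n → Word → Set
S1 n w ws = ∀ j → 1 ≤ j → j < n → ¬ InJ n w j → countEq j ws ≤ 1

S2 : (n : ℕ) → OneLine n → Word → Set
S2 n w ws = ∀ a b → IsComponent n w a b →
  ∀ u lu → IsLongest n a b u → IsLength n u lu →
  countIn a b ws ≤ lu + (suc b ∸ a)

Spherical : (n : ℕ) → OneLine n → Set
Spherical n w = ∃[ ws ] (Reduced n ws w × S1 n w ws × S2 n w ws)

Contains : ∀ {n k} → OneLine n → Vec ℕ k → Set
Contains {n} {k} w p = Σ (Fin k → Fin n) λ f →
  (∀ a b → a <ᶠ b → f a <ᶠ f b) ×
  (∀ a b → (lookup w (f a) < lookup w (f b)) ⇔ (lookup p a < lookup p b))

Avoids : ∀ {n k} → OneLine n → Vec ℕ k → Set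
Avoids w p = ¬ Contains w p

P : List (Vec ℕ 5)
P = (2 ∷ 4 ∷ 5 ∷ 3 ∷ 1 ∷ []) ∷ₗ (2 ∷ 5 ∷ 3 ∷ 1 ∷ 4 ∷ []) ∷ₗ (2 ∷ 5 ∷ 3 ∷ 4 ∷ 1 ∷ []) ∷ₗ
    (3 ∷ 4 ∷ 5 ∷ 1 ∷ 2 ∷ []) ∷ₗ (3 ∷ 4 ∷ 5 ∷ 2 ∷ 1 ∷ []) ∷ₗ (3 ∷ 5 ∷ 4 ∷ 1 ∷ 2 ∷ []) ∷ₗ
    (3 ∷ 5 ∷ 4 ∷ 2 ∷ 1 ∷ []) ∷ₗ (4 ∷ 2 ∷ 5 ∷ 3 ∷ 1 ∷ []) ∷ₗ (4 ∷ 5 ∷ 1 ∷ 2 ∷ 3 ∷ []) ∷ₗ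
    (4 ∷ 5 ∷ 2 ∷ 1 ∷ 3 ∷ []) ∷ₗ (4 ∷ 5 ∷ 2 ∷ 3 ∷ 1 ∷ []) ∷ₗ (4 ∷ 5 ∷ 3 ∷ 1 ∷ 2 ∷ []) ∷ₗ
    (5 ∷ 2 ∷ 3 ∷ 1 ∷ 4 ∷ []) ∷ₗ (5 ∷ 2 ∷ 3 ∷ 4 ∷ 1 ∷ []) ∷ₗ (5 ∷ 3 ∷ 1 ∷ 2 ∷ 4 ∷ []) ∷ₗ
    (5 ∷ 3 ∷ 1 ∷ 4 ∷ 2 ∷ []) ∷ₗ (5 ∷ 3 ∷ 4 ∷ 1 ∷ 2 ∷ []) ∷ₗ (5 ∷ 3 ∷ 4 ∷ 2 ∷ 1 ∷ []) ∷ₗ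
    (5 ∷ 4 ∷ 1 ∷ 2 ∷ 3 ∷ []) ∷ₗ (5 ∷ 4 ∷ 2 ∷ 1 ∷ 3 ∷ []) ∷ₗ (5 ∷ 4 ∷ 2 ∷ 3 ∷ 1 ∷ []) ∷ₗ []ₗ

{-# OPTIONS --safe #-}
module Submission where

-- A word is read as a wiring diagram: the string starting at position x ends at level act ws x = w x,
-- and a letter i crosses the strings at the levels i and i+1. Let J be the left descent set of w, w₀ the
-- product of the w₀(C) over the components C of J (it reverses each block of values) and v = w₀ w. Then
-- w is spherical iff v is a product of distinct generators, i.e. iff v avoids 321 and 3412, i.e. iff
-- w has no 3412 (up to swapping 3, 4 or 1, 2) whose two halves are separated by a non-descent j, j+1 of
-- values, and no 321 whose three values are so separated; spelling out the positions of the separating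
-- values gives the patterns of P.
--
-- If v = s_{i₁}⋯s_{iₖ} with distinct letters, a word for w₀ followed by this one satisfies the two counting
-- conditions, and deleting letters until the word is reduced preserves them. Conversely, a non-descent j is
-- used at most once, so at most one string passes from levels ≤ j to levels > j, which excludes 3412. A
-- separated 321 with middle value in the block {s+1,…,t} of size m forces the m strings of this block and
-- the two outer strings to have at least m(m-1)/2 + m + 2 crossings, all at levels s,…,t, while S1 and S2
-- only allow m(m-1)/2 + m + 1 of them.

open import Defs
open import Data.Nat using (ℕ; zero; suc; pred; _+_; _∸_; _≤_; _<_; _⊓_; _≟_; _≤?_; _<?_; z≤n; s≤s; s≤s⁻¹)
open import Data.Nat.Properties
open import Data.Fin using (Fin; toℕ; fromℕ<; #_) renaming (zero to fzero; suc to fsuc; _<_ to _<ᶠ_)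
open import Data.Fin.Permutation using (Permutation′; _⟨$⟩ʳ_; _⟨$⟩ˡ_; inverseˡ; inverseʳ)
import Data.Fin.Properties as Fin
open import Data.Fin.Properties using (toℕ<n; toℕ-fromℕ<; fromℕ<-toℕ; toℕ-injective)
open import Data.Vec using (Vec; []; _∷_; lookup)
import Data.Vec.Properties as Vec
open import Data.Vec.Properties using (lookup-map; lookup∘tabulate; tabulate∘lookup; tabulate-cong)
open import Data.List using (List; []; _∷_; length; filter; _++_; applyDownFrom)
import Data.List as List
open import Data.List.Membership.DecPropositional (Vec.≡-dec {n = 5} _≟_) using (_∈?_)
open import Data.List.Properties
  using (filter-all; filter-none; filter-accept; filter-reject; length-filter; filter-++; length-++; length-map; length-applyDownFrom)
open import Data.List.Relation.Unary.All as All using (All; []; _∷_)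
import Data.List.Relation.Unary.All.Properties as All
open import Data.List.Relation.Unary.AllPairs as AllPairs using (AllPairs; []; _∷_)
import Data.List.Relation.Unary.AllPairs.Properties as AllPairs
open import Data.List.Relation.Unary.Unique.Propositional using (Unique)
import Data.List.Relation.Unary.Unique.Propositional.Properties as Unique
open import Data.List.Relation.Binary.Sublist.Propositional using (_⊆_; []; _∷_; _∷ʳ_; ⊆-refl; ⊆-trans)
open import Data.List.Relation.Binary.Sublist.Propositional.Properties using (All-resp-⊆; filter⁺; length-mono-≤)
open import Data.Product using (Σ; ∃-syntax; _×_; _,_; proj₁; proj₂; uncurry)
open import Data.Sum using (_⊎_; inj₁; inj₂)
open import Data.Unit using (⊤; tt)
open import Data.Empty using (⊥; ⊥-elim)
open import Function using (_∘_; id)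
open import Function.Bundles using (_⇔_; mk⇔; Equivalence)
open import Relation.Binary using (tri<; tri≈; tri>)
open import Relation.Binary.PropositionalEquality hiding (J)
open import Relation.Nullary using (¬_; Dec; yes; no; contradiction; _×-dec_)
open import Relation.Nullary.Decidable using (True; toWitness; decidable-stable)
open import Relation.Unary using (Decidable)

-- Adjacent transpositions

swapVal-here : ∀ i → swapVal i i ≡ suc i
swapVal-here i with i ≟ i
... | yes _ = refl
... | no ne = contradiction refl ne

swapVal-next : ∀ i → swapVal i (suc i) ≡ i
swapVal-next i with suc i ≟ i
... | yes e = contradiction e 1+n≢n
... | no _ with suc i ≟ suc i
...   | yes _ = refl
...   | no ne = contradiction refl ne

swapVal-other : ∀ i {x} → x ≢ i → x ≢ suc i → swapVal i x ≡ x
swapVal-other i {x} ne ne' with x ≟ i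
... | yes e = contradiction e ne
... | no _ with x ≟ suc i
...   | yes e = contradiction e ne'
...   | no _ = refl

data SwapView (i : ℕ) : ℕ → ℕ → Set where
  here  : SwapView i i (suc i)
  next  : SwapView i (suc i) i
  other : ∀ {x} → x ≢ i → x ≢ suc i → SwapView i x x

swapView : ∀ i x → SwapView i x (swapVal i x)
swapView i x with x ≟ i
... | yes refl = here
... | no ne with x ≟ suc i
...   | yes refl = next
...   | no ne' = other ne ne'

swapVal-involutive : ∀ i x → swapVal i (swapVal i x) ≡ x
swapVal-involutive i x with swapVal i x | swapView i x
... | _ | here = swapVal-next i
... | _ | next = swapVal-here i
... | _ | other ne ne' = swapVal-other i ne ne'

swapVal-injective : ∀ i {x y} → swapVal i x ≡ swapVal i y → x ≡ y
swapVal-injective i {x} {y} e =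
  trans (sym (swapVal-involutive i x)) (trans (cong (swapVal i) e) (swapVal-involutive i y))

swapVal-mono-< : ∀ i {x y} → x < y → ¬ (x ≡ i × y ≡ suc i) → swapVal i x < swapVal i y
swapVal-mono-< i {x} {y} x<y ¬adj
  with swapVal i x | swapView i x | swapVal i y | swapView i y
... | _ | here | _ | here = contradiction refl (<⇒≢ x<y)
... | _ | here | _ | next = contradiction (refl , refl) ¬adj
... | _ | here | _ | other _ ne' = ≤∧≢⇒< x<y (ne' ∘ sym)
... | _ | next | _ | here = contradiction x<y (≤⇒≯ (n≤1+n i))
... | _ | next | _ | next = contradiction refl (<⇒≢ x<y)
... | _ | next | _ | other _ _ = <-trans (n<1+n i) x<y
... | _ | other _ _ | _ | here = <-trans x<y (n<1+n i)
... | _ | other ne _ | _ | next = ≤∧≢⇒< (s≤s⁻¹ x<y) ne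
... | _ | other _ _ | _ | other _ _ = x<y

swapVal-≤ : ∀ {i j x} → i ≢ j → x ≤ j → swapVal i x ≤ j
swapVal-≤ {i} {j} {x} i≢j x≤j with swapVal i x | swapView i x
... | _ | here = ≤∧≢⇒< x≤j i≢j
... | _ | next = <⇒≤ x≤j
... | _ | other _ _ = x≤j

swapVal-> : ∀ {i j x} → i ≢ j → j < x → j < swapVal i x
swapVal-> {i} {j} {x} i≢j j<x =
  ≰⇒> (λ le → <⇒≱ j<x (subst (_≤ j) (swapVal-involutive i x) (swapVal-≤ i≢j le)))

-- The action of words

act : Word → ℕ → ℕ
act ws x = List.foldr swapVal x ws

unact : Word → ℕ → ℕ
unact [] x = x
unact (i ∷ ws) x = unact ws (swapVal i x)

act-unact : ∀ ws x → act ws (unact ws x) ≡ x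
act-unact [] x = refl
act-unact (i ∷ ws) x = trans (cong (swapVal i) (act-unact ws (swapVal i x))) (swapVal-involutive i x)

unact-act : ∀ ws x → unact ws (act ws x) ≡ x
unact-act [] x = refl
unact-act (i ∷ ws) x = trans (cong (unact ws) (swapVal-involutive i (act ws x))) (unact-act ws x)

act-injective : ∀ ws {x y} → act ws x ≡ act ws y → x ≡ y
act-injective ws {x} {y} e = trans (sym (unact-act ws x)) (trans (cong (unact ws) e) (unact-act ws y))

act-++ : ∀ us ws x → act (us ++ ws) x ≡ act us (act ws x)
act-++ [] ws x = refl
act-++ (i ∷ us) ws x = cong (swapVal i) (act-++ us ws x)

-- Inversions and the exchange property

Inv : (ℕ → ℕ) → ℕ × ℕ → Set
Inv f (x , y) = x < y × f y < f x

-- Left multiplication by `s_i` reverses the order of the levels `i` and `i+1` only, so just the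
-- pair of strings at these levels can gain an inversion.
inv-swap : ∀ i f {x y} → Inv (swapVal i ∘ f) (x , y) →
           Inv f (x , y) ⊎ (f x ≡ i × f y ≡ suc i)
inv-swap i f {x} {y} (x<y , lt) with <-cmp (f x) (f y)
... | tri> _ _ fy<fx = inj₁ (x<y , fy<fx)
... | tri≈ _ e _ = contradiction lt (<-irrefl (cong (swapVal i) (sym e)))
... | tri< fx<fy _ _ = inj₂ (decidable-stable ((f x ≟ i) ×-dec (f y ≟ suc i))
        (λ ¬adj → <-asym (swapVal-mono-< i fx<fy ¬adj) lt))

-- `g` is `f` precomposed with the transposition of `x` and `y`.
record Exchanged (f g : ℕ → ℕ) (x y : ℕ) : Set where
  field
    left  : g x ≡ f y
    right : g y ≡ f x
    rest  : ∀ z → z ≢ x → z ≢ y → g z ≡ f z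

open Exchanged

-- Strong exchange condition. Some letter crosses the strings `x` and `y`; deleting it makes them
-- trade ends. The result is a sublist, so upper bounds on letter counts pass to it.
exchange : ∀ ws {x y} → Inv (act ws) (x , y) →
           ∃[ ws' ] (ws' ⊆ ws × length ws ≡ suc (length ws') × Exchanged (act ws) (act ws') x y)
exchange [] (x<y , y<x) = contradiction y<x (<-asym x<y)
exchange (i ∷ ws) {x} {y} v with inv-swap i (act ws) v
... | inj₁ v' with exchange ws v'
...   | ws' , sub , len , ex = i ∷ ws' , refl ∷ sub , cong suc len ,
        record { left = cong (swapVal i) (left ex) ; right = cong (swapVal i) (right ex)
               ; rest = λ z ne ne' → cong (swapVal i) (rest ex z ne ne') }
exchange (i ∷ ws) {x} {y} v | inj₂ (ex , ey) = ws , i ∷ʳ ⊆-refl , refl ,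
  record { left = trans ex (sym (trans (cong (swapVal i) ey) (swapVal-next i)))
         ; right = trans ey (sym (trans (cong (swapVal i) ex) (swapVal-here i)))
         ; rest = λ z ne ne' → sym (swapVal-other i
             (λ e → ne (act-injective ws (trans e (sym ex))))
             (λ e → ne' (act-injective ws (trans e (sym ey))))) }

exchange-swap : ∀ {f g x y i} → (∀ {a b} → f a ≡ f b → a ≡ b) → Exchanged f g x y →
                f x ≡ suc i → f y ≡ i → ∀ z → g z ≡ swapVal i (f z)
exchange-swap {f} {g} {x} {y} {i} inj ex fx fy z with z ≟ x | z ≟ y
... | yes refl | _ = trans (left ex) (trans fy (sym (trans (cong (swapVal i) fx) (swapVal-next i))))
... | no _ | yes refl = trans (right ex) (trans fx (sym (trans (cong (swapVal i) fy) (swapVal-here i))))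
... | no ne | no ne' = trans (rest ex z ne ne') (sym (swapVal-other i
        (λ e → ne' (inj (trans e (sym fy)))) (λ e → ne (inj (trans e (sym fx))))))

-- Reducedness read off the diagram: every letter crosses two strings that started in increasing
-- order, so it adds an inversion. No competing words are mentioned.
NoRecross : Word → Set
NoRecross [] = ⊤
NoRecross (i ∷ ws) = unact ws i < unact ws (suc i) × NoRecross ws

-- The first letter leaves an inverted pair at the levels `i`, `i+1`. A competing word inverts the
-- same pair, so `exchange` strips one of its letters and leaves a word for the tail.
noRecross-minimal : ∀ ws → NoRecross ws → ∀ ws' → (∀ x → act ws' x ≡ act ws x) → length ws ≤ length ws'
noRecross-minimal [] _ ws' e = z≤n
noRecross-minimal (i ∷ ws) (lt , nr) ws' e = shorten (exchange ws' (lt , subst₂ _<_ (sym at-y) (sym at-x) (n<1+n i)))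
  where
  at-x : act ws' (unact ws i) ≡ suc i
  at-x = trans (e _) (trans (cong (swapVal i) (act-unact ws i)) (swapVal-here i))
  at-y : act ws' (unact ws (suc i)) ≡ i
  at-y = trans (e _) (trans (cong (swapVal i) (act-unact ws (suc i))) (swapVal-next i))
  shorten : ∃[ us ] (us ⊆ ws' × length ws' ≡ suc (length us) × Exchanged (act ws') (act us) (unact ws i) (unact ws (suc i))) →
            suc (length ws) ≤ length ws'
  shorten (us , _ , len , ex) = subst (suc (length ws) ≤_) (sym len) (s≤s (noRecross-minimal ws nr us λ x →
    trans (exchange-swap {i = i} (act-injective ws') ex at-x at-y x)
          (trans (cong (swapVal i) (e x)) (swapVal-involutive i (act ws x)))))

-- If the letter `i` recrosses two strings, both it and the letter of `us` where they crossed are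
-- deleted, without changing the action. What remains is no subterm and may fail `NoRecross`, hence
-- the recursion on a length bound.
reduce-bounded : ∀ N ws → length ws ≤ N →
                 ∃[ ws' ] (ws' ⊆ ws × NoRecross ws' × (∀ x → act ws' x ≡ act ws x))
reduce-bounded N [] _ = [] , [] , tt , λ _ → refl
reduce-bounded (suc N) (i ∷ ws) (s≤s le) with reduce-bounded N ws le
... | us , sub , nr , same with unact us i <? unact us (suc i)
...   | yes lt = i ∷ us , refl ∷ sub , (lt , nr) , λ x → cong (swapVal i) (same x)
...   | no ≮ with exchange us inverted
  where
  inverted : Inv (act us) (unact us (suc i) , unact us i)
  inverted = ≤∧≢⇒< (≮⇒≥ ≮) (λ e → 1+n≢n (trans (sym (act-unact us (suc i))) (trans (cong (act us) e) (act-unact us i))))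
           , subst₂ _<_ (sym (act-unact us i)) (sym (act-unact us (suc i))) (n<1+n i)
...     | us' , sub' , len , ex
        with reduce-bounded N us' (≤-trans (<⇒≤ (≤-reflexive (sym len))) (≤-trans (length-mono-≤ sub) le))
...       | vs , sub'' , nr' , same' = vs , i ∷ʳ ⊆-trans sub'' (⊆-trans sub' sub) , nr' ,
            λ x → trans (same' x) (trans (exchange-swap (act-injective us) ex (act-unact us (suc i)) (act-unact us i) x)
                                         (cong (swapVal i) (same x)))

reduce : ∀ ws → ∃[ ws' ] (ws' ⊆ ws × NoRecross ws' × (∀ x → act ws' x ≡ act ws x))
reduce ws = reduce-bounded (length ws) ws ≤-refl

-- Counting letters

countEq-here : ∀ j ws → countEq j (j ∷ ws) ≡ suc (countEq j ws)
countEq-here j ws = cong length (filter-accept (λ i → i ≟ j) refl)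

countEq-skip : ∀ {i j} ws → i ≢ j → countEq j (i ∷ ws) ≡ countEq j ws
countEq-skip {i} {j} ws ne = cong length (filter-reject (λ i → i ≟ j) ne)

countEq-none : ∀ {j} ws → All (_≢ j) ws → countEq j ws ≡ 0
countEq-none {j} ws ne = cong length (filter-none (λ i → i ≟ j) ne)

countEq-++ : ∀ j us ws → countEq j (us ++ ws) ≡ countEq j us + countEq j ws
countEq-++ j us ws = trans (cong length (filter-++ (λ i → i ≟ j) us ws)) (length-++ (filter (λ i → i ≟ j) us))

countEq-⊆ : ∀ j {us ws} → us ⊆ ws → countEq j us ≤ countEq j ws
countEq-⊆ j sub = length-mono-≤ (filter⁺ (λ i → i ≟ j) (λ i → i ≟ j) (λ { refl p → p }) sub)

in? : ∀ a b → Decidable (λ i → a ≤ i × i ≤ b)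
in? a b i = (a ≤? i) ×-dec (i ≤? b)

countIn-here : ∀ {a b i} ws → a ≤ i × i ≤ b → countIn a b (i ∷ ws) ≡ suc (countIn a b ws)
countIn-here {a} {b} ws p = cong length (filter-accept (in? a b) p)

countIn-skip : ∀ {a b i} ws → ¬ (a ≤ i × i ≤ b) → countIn a b (i ∷ ws) ≡ countIn a b ws
countIn-skip {a} {b} ws p = cong length (filter-reject (in? a b) p)

countIn-none : ∀ {a b} ws → All (λ i → ¬ (a ≤ i × i ≤ b)) ws → countIn a b ws ≡ 0
countIn-none {a} {b} ws ne = cong length (filter-none (in? a b) ne)

countIn-all : ∀ {a b} ws → All (λ i → a ≤ i × i ≤ b) ws → countIn a b ws ≡ length ws
countIn-all {a} {b} ws p = cong length (filter-all (in? a b) p)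

countIn-++ : ∀ a b us ws → countIn a b (us ++ ws) ≡ countIn a b us + countIn a b ws
countIn-++ a b us ws = trans (cong length (filter-++ (in? a b) us ws)) (length-++ (filter (in? a b) us))

countIn-⊆ : ∀ a b {us ws} → us ⊆ ws → countIn a b us ≤ countIn a b ws
countIn-⊆ a b sub = length-mono-≤ (filter⁺ (in? a b) (in? a b) (λ { refl p → p }) sub)

countIn≤length : ∀ a b ws → countIn a b ws ≤ length ws
countIn≤length a b ws = length-filter (in? a b) ws

length-filter-cover : ∀ {A B C : ℕ → Set} (A? : Decidable A) (B? : Decidable B) (C? : Decidable C) →
                      (∀ {i} → A i → B i ⊎ C i) → ∀ ws →
                      length (filter A? ws) ≤ length (filter B? ws) + length (filter C? ws)
length-filter-cover A? B? C? cover [] = z≤n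
length-filter-cover A? B? C? cover (i ∷ ws) with A? i | B? i | C? i | length-filter-cover A? B? C? cover ws
... | no _ | no _ | no _ | le = le
... | no _ | no _ | yes _ | le = ≤-trans le (+-monoʳ-≤ (length (filter B? ws)) (n≤1+n _))
... | no _ | yes _ | no _ | le = m≤n⇒m≤1+n le
... | no _ | yes _ | yes _ | le = m≤n⇒m≤1+n (≤-trans le (+-monoʳ-≤ (length (filter B? ws)) (n≤1+n _)))
... | yes _ | yes _ | no _ | le = s≤s le
... | yes _ | yes _ | yes _ | le = s≤s (≤-trans le (+-monoʳ-≤ (length (filter B? ws)) (n≤1+n _)))
... | yes _ | no _ | yes _ | le = ≤-trans (s≤s le) (≤-reflexive (sym (+-suc (length (filter B? ws)) _)))
... | yes a | no ¬b | no ¬c | le with cover a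
...   | inj₁ b = contradiction b ¬b
...   | inj₂ c = contradiction c ¬c

countIn-left : ∀ a b ws → countIn a b ws ≤ countEq a ws + countIn (suc a) b ws
countIn-left a b = length-filter-cover (in? a b) (_≟ a) (in? (suc a) b) cover
  where
  cover : ∀ {i} → a ≤ i × i ≤ b → i ≡ a ⊎ (suc a ≤ i × i ≤ b)
  cover (a≤i , i≤b) with m≤n⇒m<n∨m≡n a≤i
  ... | inj₁ a<i = inj₂ (a<i , i≤b)
  ... | inj₂ a≡i = inj₁ (sym a≡i)

countIn-right : ∀ a b ws → countIn a (suc b) ws ≤ countIn a b ws + countEq (suc b) ws
countIn-right a b = length-filter-cover (in? a (suc b)) (in? a b) (_≟ suc b) cover
  where
  cover : ∀ {i} → a ≤ i × i ≤ suc b → (a ≤ i × i ≤ b) ⊎ i ≡ suc b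
  cover (a≤i , i≤b) with m≤n⇒m<n∨m≡n i≤b
  ... | inj₁ i<b = inj₁ (a≤i , s≤s⁻¹ i<b)
  ... | inj₂ i≡b = inj₂ i≡b

countIn-ends : ∀ a b ws → countIn a (suc b) ws ≤ countEq a ws + (countIn (suc a) b ws + countEq (suc b) ws)
countIn-ends a b ws = ≤-trans (countIn-left a (suc b) ws) (+-monoʳ-≤ (countEq a ws) (countIn-right (suc a) b ws))

countIn-distinct : ∀ d {a b} ws → (∀ j → countEq j ws ≤ 1) → suc b ≤ a + d → countIn a b ws ≤ d
countIn-distinct zero {a} {b} ws _ le = ≤-reflexive (countIn-none ws (All.universal
  (λ i (a≤i , i≤b) → <⇒≱ (subst (b <_) (+-identityʳ a) le) (≤-trans a≤i i≤b)) ws))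
countIn-distinct (suc d) {a} {b} ws distinct le = ≤-trans (countIn-left a b ws)
  (+-mono-≤ (distinct a) (countIn-distinct d ws distinct (subst (suc b ≤_) (+-suc a d) le)))

-- Counting crossings

-- Only crossings with `x` coming from below, which create the inversion, are restricted.
NoCrossOutside : ℕ → ℕ → Word → ℕ × ℕ → Set
NoCrossOutside lo hi [] _ = ⊤
NoCrossOutside lo hi (i ∷ ws) (x , y) =
  (¬ (lo ≤ i × i ≤ hi) → ¬ (act ws x ≡ i × act ws y ≡ suc i)) × NoCrossOutside lo hi ws (x , y)

-- Without the letter `i`, only the pair at the levels `i`, `i+1` stops being inverted, and a
-- duplicate-free list holds it at most once. `Q` carries a property over to the surviving pairs.
uncross : ∀ i f → (∀ {x y} → f x ≡ f y → x ≡ y) → {Q : ℕ × ℕ → Set} →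
          ∀ ps → Unique ps → All (Inv (swapVal i ∘ f)) ps → All Q ps →
          ∃[ ps' ] (Unique ps' × All (Inv f) ps' × All Q ps' × length ps ≤ suc (length ps'))
uncross i f inj [] _ _ _ = [] , [] , [] , [] , z≤n
uncross i f inj (p ∷ ps) (p∉ ∷ u) (v ∷ vs) (q ∷ qs) with inv-swap i f v
... | inj₂ (ex , ey) = ps , u , All.zipWith (λ { {p'} (ne , v') → still-inv ne v' }) (p∉ , vs) , qs , ≤-refl
  where
  still-inv : ∀ {p'} → p ≢ p' → Inv (swapVal i ∘ f) p' → Inv f p'
  still-inv ne v' with inv-swap i f v'
  ... | inj₁ v'' = v''
  ... | inj₂ (ex' , ey') = contradiction (cong₂ _,_ (inj (trans ex (sym ex'))) (inj (trans ey (sym ey')))) ne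
-- The freshness of `p` travels inside `Q`, so that it also holds for the returned list.
... | inj₁ v' with uncross i f inj ps u vs (All.zip (p∉ , qs))
...   | ps' , u' , vs' , qs' , le with All.unzip qs'
...     | p∉' , qs'' = p ∷ ps' , p∉' ∷ u' , v' ∷ vs' , q ∷ qs'' , s≤s le

-- Each inversion is created by a letter crossing its two strings, and distinct pairs need distinct
-- letters; `NoCrossOutside` places these letters between `lo` and `hi`.
inversions≤countIn : ∀ lo hi ws ps → Unique ps → All (Inv (act ws)) ps →
                     All (NoCrossOutside lo hi ws) ps → length ps ≤ countIn lo hi ws
inversions≤countIn lo hi [] [] _ _ _ = z≤n
inversions≤countIn lo hi [] (_ ∷ _) _ ((x<y , y<x) ∷ _) _ = contradiction y<x (<-asym x<y)
inversions≤countIn lo hi (i ∷ ws) ps u vs nc = step (in? lo hi i)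
  where
  step : Dec (lo ≤ i × i ≤ hi) → length ps ≤ countIn lo hi (i ∷ ws)
  step (yes ∈) with uncross i (act ws) (act-injective ws) ps u vs (All.map proj₂ nc)
  ... | ps' , u' , vs' , nc' , le = ≤-trans le (≤-trans (s≤s (inversions≤countIn lo hi ws ps' u' vs' nc'))
                                                         (≤-reflexive (sym (countIn-here ws ∈))))
  step (no ∉) = ≤-trans (inversions≤countIn lo hi ws ps u (All.zipWith (uncurry still-inv) (vs , nc)) (All.map proj₂ nc))
                        (≤-reflexive (sym (countIn-skip ws ∉)))
    where
    still-inv : ∀ {p} → Inv (act (i ∷ ws)) p → NoCrossOutside lo hi (i ∷ ws) p → Inv (act ws) p
    still-inv v n with inv-swap i (act ws) v
    ... | inj₁ v' = v'
    ... | inj₂ e = contradiction e (proj₁ n ∉)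

-- Strings on either side of a cut

countEq≡0⇒All≢ : ∀ j ws → countEq j ws ≡ 0 → All (_≢ j) ws
countEq≡0⇒All≢ j [] _ = []
countEq≡0⇒All≢ j (i ∷ ws) e = i≢j ∷ countEq≡0⇒All≢ j ws (trans (sym (countEq-skip ws i≢j)) e)
  where
  i≢j : i ≢ j
  i≢j refl = contradiction (trans (sym (countEq-here j ws)) e) 1+n≢0

countEq≤1⇒All≢ : ∀ j ws → countEq j (j ∷ ws) ≤ 1 → All (_≢ j) ws
countEq≤1⇒All≢ j ws le = countEq≡0⇒All≢ j ws (n≤0⇒n≡0 (s≤s⁻¹ (subst (_≤ 1) (countEq-here j ws) le)))

countEq-tail : ∀ {j m} i ws → countEq j (i ∷ ws) ≤ m → countEq j ws ≤ m
countEq-tail {j} i ws le = ≤-trans (countEq-⊆ j {ws} (i ∷ʳ ⊆-refl)) le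

-- `R` stands for either half-line of levels bounded by the cut between `j` and `j+1`; only the
-- letter `j` carries a string across.
module Side (R : ℕ → Set) (j : ℕ)
            (preserved : ∀ {i x} → i ≢ j → R x → R (swapVal i x)) where

  preserved⁻ : ∀ {i x} → i ≢ j → R (swapVal i x) → R x
  preserved⁻ {i} {x} i≢j r = subst R (swapVal-involutive i x) (preserved i≢j r)

  act-preserves : ∀ {ws x} → All (_≢ j) ws → R x → R (act ws x)
  act-preserves [] r = r
  act-preserves (ne ∷ nes) r = preserved ne (act-preserves nes r)

  act-reflects : ∀ {ws x} → All (_≢ j) ws → R (act ws x) → R x
  act-reflects [] r = r
  act-reflects (ne ∷ nes) r = act-reflects nes (preserved⁻ ne r)

  Apart : Word → ℕ → ℕ → Set
  Apart [] x y = ⊤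
  Apart (i ∷ ws) x y = ¬ (R (act ws x) × R (act ws y)) × Apart ws x y

  -- As `j` occurs at most once, it is missing before or after any given moment. Two strings
  -- together in `R` at that moment are therefore together in `R` at the start or at the end.
  apart : ∀ ws {x y} → countEq j ws ≤ 1 → ¬ (R x × R y) → ¬ (R (act ws x) × R (act ws y)) → Apart ws x y
  apart [] _ _ _ = tt
  apart (i ∷ ws) {x} {y} le start end = before , apart ws (countEq-tail i ws le) start before
    where
    before : ¬ (R (act ws x) × R (act ws y))
    before (rx , ry) with i ≟ j
    ... | no i≢j = end (preserved i≢j rx , preserved i≢j ry)
    ... | yes refl = start (act-reflects ≢j rx , act-reflects ≢j ry)
      where ≢j = countEq≤1⇒All≢ j ws le

  -- The single letter `j` takes out of `R` only the string at the boundary level `e`, and no two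
  -- strings share a level.
  leave-once : ∀ {e} → (∀ {x} → R x → ¬ R (swapVal j x) → x ≡ e) → ∀ ws {x y} → countEq j ws ≤ 1 →
               R x → R y → ¬ R (act ws x) → ¬ R (act ws y) → x ≡ y
  leave-once exit [] _ rx _ ¬rx _ = contradiction rx ¬rx
  leave-once exit (i ∷ ws) {x} {y} le rx ry ¬rx ¬ry with i ≟ j
  ... | no i≢j = leave-once exit ws (countEq-tail i ws le) rx ry (¬rx ∘ preserved i≢j) (¬ry ∘ preserved i≢j)
  ... | yes refl = act-injective ws (trans (exit (act-preserves ≢j rx) ¬rx) (sym (exit (act-preserves ≢j ry) ¬ry)))
    where ≢j = countEq≤1⇒All≢ j ws le

module Low (j : ℕ) where
  open Side (_≤ j) j swapVal-≤ public

  exit : ∀ {x} → x ≤ j → ¬ (swapVal j x ≤ j) → x ≡ j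
  exit {x} x≤j ¬le with swapVal j x | swapView j x
  ... | _ | here = refl
  ... | _ | next = contradiction ≤-refl ¬le
  ... | _ | other _ _ = contradiction x≤j ¬le

module High (j : ℕ) where
  open Side (j <_) j swapVal-> public

  exit : ∀ {x} → j < x → ¬ (j < swapVal j x) → x ≡ suc j
  exit {x} j<x ¬lt with swapVal j x | swapView j x
  ... | _ | here = contradiction ≤-refl ¬lt
  ... | _ | next = refl
  ... | _ | other _ _ = contradiction j<x ¬lt

-- A letter `i < lo` crosses strings at the levels `i` and `i+1 ≤ lo`, both low; a letter `i > hi`
-- crosses two strings above `hi`.
noCrossOutside : ∀ lo hi ws {x y} → Low.Apart lo ws x y → High.Apart hi ws x y → NoCrossOutside lo hi ws (x , y)
noCrossOutside lo hi [] _ _ = tt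
noCrossOutside lo hi (i ∷ ws) {x} {y} (low , lows) (high , highs) = ok , noCrossOutside lo hi ws lows highs
  where
  ok : ¬ (lo ≤ i × i ≤ hi) → ¬ (act ws x ≡ i × act ws y ≡ suc i)
  ok ∉ (ex , ey) with lo ≤? i
  ... | no lo≰i = low (subst (_≤ lo) (sym ex) (<⇒≤ (≰⇒> lo≰i)) , subst (_≤ lo) (sym ey) (≰⇒> lo≰i))
  ... | yes lo≤i = high (subst (hi <_) (sym ex) hi<i , subst (hi <_) (sym ey) (m<n⇒m<1+n hi<i))
    where
    hi<i : hi < i
    hi<i = ≰⇒> (λ i≤hi → ∉ (lo≤i , i≤hi))

-- Pairs of list elements

-- The triangular number m(m-1)/2, which is the length of `w₀` of a block of `m` values.
tri : ℕ → ℕ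
tri zero = 0
tri (suc m) = m + tri m

tri-mono : ∀ {m n} → m ≤ n → tri m ≤ tri n
tri-mono z≤n = z≤n
tri-mono (s≤s m≤n) = +-mono-≤ m≤n (tri-mono m≤n)

pairs : List ℕ → List (ℕ × ℕ)
pairs [] = []
pairs (d ∷ ds) = List.map (d ,_) ds ++ pairs ds

length-pairs : ∀ ds → length (pairs ds) ≡ tri (length ds)
length-pairs [] = refl
length-pairs (d ∷ ds) = trans (length-++ (List.map (d ,_) ds)) (cong₂ _+_ (length-map (d ,_) ds) (length-pairs ds))

pairs-all : ∀ {R : ℕ × ℕ → Set} {ds} → AllPairs (λ x y → R (x , y)) ds → All R (pairs ds)
pairs-all [] = []
pairs-all (r ∷ rs) = All.++⁺ (All.map⁺ r) (pairs-all rs)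

pairs-elements : ∀ {Q : ℕ → Set} {ds} → All Q ds → All (λ p → Q (proj₁ p) × Q (proj₂ p)) (pairs ds)
pairs-elements [] = []
pairs-elements (q ∷ qs) = All.++⁺ (All.map⁺ (All.map (q ,_) qs)) (pairs-elements qs)

pairs-unique : ∀ {ds} → Unique ds → Unique (pairs ds)
pairs-unique [] = []
pairs-unique {d ∷ ds} (d∉ ∷ u) =
  AllPairs.++⁺ (Unique.map⁺ (cong proj₂) u) (pairs-unique u)
    (All.map⁺ (All.universal (λ _ → All.map (λ q e → proj₁ q (cong proj₁ e)) (pairs-elements d∉)) ds))

-- The list starts with the largest argument, so it is increasing when `g` decreases on the block.
block : (ℕ → ℕ) → ℕ → ℕ → List ℕ
block g s m = applyDownFrom (λ k → g (s + k)) m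

block-inversions : ∀ {f g : ℕ → ℕ} s m → (∀ x → f (g x) ≡ x) →
                   (∀ {u v} → s ≤ u → u < v → v < s + m → g v < g u) →
                   AllPairs (λ x y → Inv f (x , y)) (block g s m)
block-inversions s m fg anti = AllPairs.applyDownFrom⁺₁ _ m λ {u} {v} v<u u<m →
  anti (m≤m+n s v) (+-monoʳ-< s v<u) (+-monoʳ-< s u<m) ,
  subst₂ _<_ (sym (fg _)) (sym (fg _)) (+-monoʳ-< s v<u)

inversions⇒unique : ∀ {f ds} → AllPairs (λ x y → Inv f (x , y)) ds → Unique ds
inversions⇒unique = AllPairs.map (λ v → <⇒≢ (proj₁ v))

-- Words for parabolic elements by insertion sort

swapVal-fix : ∀ {i x} → suc i < x → swapVal i x ≡ x
swapVal-fix {i} lt = swapVal-other i (<⇒≢ (<-trans (n<1+n i) lt) ∘ sym) (<⇒≢ lt ∘ sym)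

act-fix : ∀ {ws x} → All (λ i → suc i < x) ws → act ws x ≡ x
act-fix [] = refl
act-fix {i ∷ ws} (lt ∷ lts) = trans (cong (swapVal i) (act-fix lts)) (swapVal-fix lt)

unact-fix : ∀ {ws x} → All (λ i → suc i < x) ws → unact ws x ≡ x
unact-fix [] = refl
unact-fix {i ∷ ws} (lt ∷ lts) = trans (cong (unact ws) (swapVal-fix lt)) (unact-fix lts)

-- The letters k, k+1, ..., k+d-1; their product is a cycle moving the level `k + d` down to `k`.
run : ℕ → ℕ → Word
run zero k = []
run (suc d) k = k ∷ run d (suc k)

run-range : ∀ d k → All (λ i → k ≤ i × i < k + d) (run d k)
run-range zero k = []
run-range (suc d) k = (≤-refl , m<m+n k (s≤s z≤n)) ∷
  All.map (λ { {i} (le , lt) → <⇒≤ le , subst (i <_) (sym (+-suc k d)) lt }) (run-range d (suc k))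

length-run : ∀ d k → length (run d k) ≡ d
length-run zero k = refl
length-run (suc d) k = cong suc (length-run d (suc k))

unact-run : ∀ d k → unact (run d k) k ≡ k + d
unact-run zero k = sym (+-identityʳ k)
unact-run (suc d) k = trans (cong (unact (run d (suc k))) (swapVal-here k)) (trans (unact-run d (suc k)) (sym (+-suc k d)))

-- The number of values in {a,…,b+1} that are at most n.
blockSize : ℕ → ℕ → ℕ → ℕ
blockSize n a b = suc (n ⊓ suc b) ∸ a

blockSize-mono : ∀ {m n} a b → m ≤ n → blockSize m a b ≤ blockSize n a b
blockSize-mono a b m≤n = ∸-monoˡ-≤ a (s≤s (⊓-monoˡ-≤ (suc b) m≤n))

module Sort (J : ℕ → Set) (J? : Decidable J) where

  run-contains : ∀ {d k} j → k ≤ j → j < k + d → All J (run d k) → J j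
  run-contains {zero} {k} j k≤j j<k _ = contradiction (subst (j <_) (+-identityʳ k) j<k) (≤⇒≯ k≤j)
  run-contains {suc d} {k} j k≤j j<k+d (jk ∷ js) with k ≟ j
  ... | yes refl = jk
  ... | no k≢j = run-contains j (≤∧≢⇒< k≤j k≢j) (subst (j <_) (+-suc k d) j<k+d) js

  run-start : ∀ a {d k n} → a ≤ n → ¬ J (pred a) → k + d ≡ suc n → All J (run d k) → a ≤ k
  run-start zero _ _ _ _ = z≤n
  run-start (suc a) a<n ¬Ja e js =
    ≰⇒> λ k≤a → ¬Ja (run-contains a k≤a (subst (a <_) (sym e) (m<n⇒m<1+n a<n)) js)

  -- Inserting `n+1` costs at most one letter per smaller value of its block, because a run inside
  -- `J` avoids the letters `a-1` and `b+1`. For `n < a` it stays below the interval; for `n > b` a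
  -- letter in the interval would bring in `b+1`; otherwise it starts at or above `a` and has at
  -- most `n+1-a` letters.
  run-countIn : ∀ {d k n} a b → k + d ≡ suc n → All J (run d k) → ¬ J (pred a) → ¬ J (suc b) →
                countIn a b (run d k) + tri (blockSize n a b) ≤ tri (blockSize (suc n) a b)
  run-countIn {d} {k} {n} a b kd js ¬Ja ¬Jb with a ≤? n | n ≤? b
  ... | no a≰n | _ = ≤-trans (≤-reflexive (cong (_+ tri (blockSize n a b)) (countIn-none (run d k) (All.map outside (run-range d k)))))
                             (tri-mono (blockSize-mono a b (n≤1+n n)))
    where
    outside : ∀ {i} → k ≤ i × i < k + d → ¬ (a ≤ i × i ≤ b)
    outside {i} (_ , lt) (a≤i , _) = a≰n (≤-trans a≤i (s≤s⁻¹ (subst (i <_) kd lt)))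
  ... | yes a≤n | no n≰b = ≤-trans (≤-reflexive (cong (_+ tri (blockSize n a b)) (countIn-none (run d k) (All.map outside (run-range d k)))))
                                   (tri-mono (blockSize-mono a b (n≤1+n n)))
    where
    outside : ∀ {i} → k ≤ i × i < k + d → ¬ (a ≤ i × i ≤ b)
    outside (k≤i , _) (_ , i≤b) = ¬Jb (run-contains (suc b) (m≤n⇒m≤1+n (≤-trans k≤i i≤b))
      (subst (suc b <_) (sym kd) (s≤s (≰⇒> n≰b))) js)
  ... | yes a≤n | yes n≤b = begin
      countIn a b (run d k) + tri (blockSize n a b) ≤⟨ +-monoˡ-≤ _ (countIn≤length a b (run d k)) ⟩
      length (run d k) + tri (blockSize n a b)      ≡⟨ cong (_+ tri (blockSize n a b)) (length-run d k) ⟩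
      d + tri (blockSize n a b)                     ≤⟨ +-monoˡ-≤ _ d≤ ⟩
      suc n ∸ a + tri (blockSize n a b)             ≡⟨ cong (λ m → suc n ∸ a + tri (suc m ∸ a)) (m≤n⇒m⊓n≡m (m≤n⇒m≤1+n n≤b)) ⟩
      tri (suc (suc n ∸ a))                         ≡⟨ cong tri (sym (+-∸-assoc 1 (m≤n⇒m≤1+n a≤n))) ⟩
      tri (suc (suc n) ∸ a)                         ≡⟨ cong (λ m → tri (suc m ∸ a)) (sym (m≤n⇒m⊓n≡m (s≤s n≤b))) ⟩
      tri (blockSize (suc n) a b)                   ∎
      where
      open ≤-Reasoning
      d≤ : d ≤ suc n ∸ a
      d≤ = subst (_≤ suc n ∸ a) (trans (cong (_∸ k) (sym kd)) (m+n∸m≡n k d))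
                 (∸-monoʳ-≤ (suc n) (run-start a a≤n ¬Ja kd js))

  SortedWord : ℕ → (ℕ → ℕ) → Set
  SortedWord n f = ∃[ ws ] (All J ws × (∀ x → act ws x ≡ f x) ×
    (∀ a b → ¬ J (pred a) → ¬ J (suc b) → countIn a b ws ≤ tri (blockSize n a b)))

  -- Insertion sort: a run brings the string of `n+1` to its level, and the remaining factor fixes
  -- `n+1`. The last hypothesis says that `f` preserves the blocks of `J`; for a permutation one
  -- implication suffices.
  sortWord : ∀ n (f : ℕ → ℕ) → (∀ {x y} → f x ≡ f y → x ≡ y) → (∀ {x} → n < x → f x ≡ x) →
             (∀ {j x} → ¬ J j → f x ≤ j → x ≤ j) →
             SortedWord n f
  sortWord zero f inj fix cut = [] , [] , sym ∘ f≡id , λ _ _ _ _ → z≤n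
    where
    f≡id : ∀ x → f x ≡ x
    f≡id (suc x) = fix (s≤s z≤n)
    f≡id zero with f 0 in e
    ... | zero = refl
    ... | suc k = sym (inj (trans e (sym (fix (s≤s z≤n)))))
  sortWord (suc n) f inj fix cut = row ++ ws , All.++⁺ row-J ws-J , same , count
    where
    k d : ℕ
    k = f (suc n)
    k≤ : k ≤ suc n
    k≤ = ≮⇒≥ (λ lt → <⇒≢ lt (inj (sym (fix lt))))
    d = suc n ∸ k
    kd : k + d ≡ suc n
    kd = m+[n∸m]≡n k≤
    row : Word
    row = run d k
    row-J : All J row
    -- A letter `j` of the row satisfies `f (n+1) ≤ j < n+1`, which `cut` forbids unless `j` lies in
    -- `J`.
    row-J = All.map (λ { {j} (k≤j , j<) → decidable-stable (J? j)
      (λ ¬Jj → <⇒≱ (subst (j <_) kd j<) (cut ¬Jj k≤j)) }) (run-range d k)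
    f' : ℕ → ℕ
    f' x = unact row (f x)
    fix' : ∀ {x} → n < x → f' x ≡ x
    fix' {x} n<x with x ≟ suc n
    ... | yes refl = trans (unact-run d k) kd
    ... | no ne = trans (cong (unact row) (fix lt))
                        (unact-fix (All.map (λ { {i} (_ , i<) → ≤-<-trans (subst (i <_) kd i<) lt }) (run-range d k)))
      where lt = ≤∧≢⇒< n<x (ne ∘ sym)
    inj' : ∀ {x y} → f' x ≡ f' y → x ≡ y
    inj' {x} {y} e = inj (trans (sym (act-unact row (f x))) (trans (cong (act row) e) (act-unact row (f y))))
    cut' : ∀ {j x} → ¬ J j → f' x ≤ j → x ≤ j
    cut' {j} {x} ¬Jj le = cut ¬Jj (subst (_≤ j) (act-unact row (f x))
      (Low.act-preserves j {row} (All.map (λ ji e → ¬Jj (subst J e ji)) row-J) le))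
    rec = sortWord n f' inj' fix' cut'
    ws = proj₁ rec
    ws-J = proj₁ (proj₂ rec)
    same : ∀ x → act (row ++ ws) x ≡ f x
    same x = trans (act-++ row ws x) (trans (cong (act row) (proj₁ (proj₂ (proj₂ rec)) x)) (act-unact row (f x)))
    count : ∀ a b → ¬ J (pred a) → ¬ J (suc b) → countIn a b (row ++ ws) ≤ tri (blockSize (suc n) a b)
    count a b ¬Ja ¬Jb = ≤-trans (≤-reflexive (countIn-++ a b row ws))
      (≤-trans (+-monoʳ-≤ (countIn a b row) (proj₂ (proj₂ (proj₂ rec)) a b ¬Ja ¬Jb))
               (run-countIn a b kd row-J ¬Ja ¬Jb))

-- Reversing each maximal interval of values joined by letters of J

module Blocks (J : ℕ → Set) (J? : Decidable J) (n : ℕ) (beyond : ∀ {j} → n ≤ j → ¬ J j) where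

  lo : ℕ → ℕ
  lo zero = zero
  lo (suc x) with J? x
  ... | yes _ = lo x
  ... | no _ = suc x

  lo≤ : ∀ x → lo x ≤ x
  lo≤ zero = z≤n
  lo≤ (suc x) with J? x
  ... | yes _ = m≤n⇒m≤1+n (lo≤ x)
  ... | no _ = ≤-refl

  lo-joined : ∀ x {j} → lo x ≤ j → j < x → J j
  lo-joined (suc x) {j} le lt with J? x
  ... | no _ = contradiction lt (≤⇒≯ le)
  ... | yes jx with j ≟ x
  ...   | yes refl = jx
  ...   | no ne = lo-joined x le (≤∧≢⇒< (s≤s⁻¹ lt) ne)

  lo-cut : ∀ x {j} → suc j ≡ lo x → ¬ J j
  lo-cut (suc x) e with J? x
  ... | yes _ = lo-cut x e
  lo-cut (suc x) refl | no ¬jx = ¬jx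

  private
    -- The first argument is fuel; `n ∸ x` suffices, as no letter from `n` on lies in `J`.
    hiFrom : ℕ → ℕ → ℕ
    hiFrom zero x = x
    hiFrom (suc d) x with J? x
    ... | yes _ = hiFrom d (suc x)
    ... | no _ = x

    ≤hiFrom : ∀ d x → x ≤ hiFrom d x
    ≤hiFrom zero x = ≤-refl
    ≤hiFrom (suc d) x with J? x
    ... | yes _ = <⇒≤ (≤hiFrom d (suc x))
    ... | no _ = ≤-refl

    hiFrom-joined : ∀ d x {j} → x ≤ j → j < hiFrom d x → J j
    hiFrom-joined zero x le lt = contradiction lt (≤⇒≯ le)
    hiFrom-joined (suc d) x {j} le lt with J? x
    ... | no _ = contradiction lt (≤⇒≯ le)
    ... | yes jx with x ≟ j
    ...   | yes refl = jx
    ...   | no ne = hiFrom-joined d (suc x) (≤∧≢⇒< le ne) lt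

    hiFrom-cut : ∀ d x → n ≤ x + d → ¬ J (hiFrom d x)
    hiFrom-cut zero x le = beyond (subst (n ≤_) (+-identityʳ x) le)
    hiFrom-cut (suc d) x le with J? x
    ... | yes _ = hiFrom-cut d (suc x) (subst (n ≤_) (+-suc x d) le)
    ... | no ¬jx = ¬jx

  hi : ℕ → ℕ
  hi x = hiFrom (n ∸ x) x

  ≤hi : ∀ x → x ≤ hi x
  ≤hi x = ≤hiFrom (n ∸ x) x

  hi-joined : ∀ x {j} → x ≤ j → j < hi x → J j
  hi-joined x = hiFrom-joined (n ∸ x) x

  hi-cut : ∀ x → ¬ J (hi x)
  hi-cut x = hiFrom-cut (n ∸ x) x (m≤n+m∸n n x)

  hi-least : ∀ {x j} → ¬ J j → x ≤ j → hi x ≤ j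
  hi-least {x} ¬Jj x≤j = ≮⇒≥ (¬Jj ∘ hi-joined x x≤j)

  block-joined : ∀ x {j} → lo x ≤ j → j < hi x → J j
  block-joined x {j} le lt with j <? x
  ... | yes j<x = lo-joined x le j<x
  ... | no j≮x = hi-joined x (≮⇒≥ j≮x) lt

  hi-unique : ∀ {x y} → lo x ≤ y → y ≤ hi x → hi y ≡ hi x
  hi-unique {x} {y} l h = ≤-antisym (hi-least (hi-cut x) h)
    (≮⇒≥ (hi-cut y ∘ block-joined x (≤-trans l (≤hi y))))

  lo-unique : ∀ {x y} → lo x ≤ y → y ≤ hi x → lo y ≡ lo x
  lo-unique {x} {y} l h = ≤-antisym (lo-y≤ (lo y) refl) (lo-x≤ (lo x) refl)
    where
    lo-y≤ : ∀ l → l ≡ lo y → l ≤ lo x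
    lo-y≤ zero e = z≤n
    lo-y≤ (suc j) e = ≮⇒≥ λ lt → lo-cut y e (block-joined x (s≤s⁻¹ lt) (≤-trans (subst (_≤ y) (sym e) (lo≤ y)) h))
    lo-x≤ : ∀ l → l ≡ lo x → l ≤ lo y
    lo-x≤ zero e = z≤n
    lo-x≤ (suc j) e = ≮⇒≥ λ lt → lo-cut x e (lo-joined y (s≤s⁻¹ lt) (subst (_≤ y) (sym e) l))

  rev : ℕ → ℕ
  rev x = lo x + hi x ∸ x

  rev≤hi : ∀ x → rev x ≤ hi x
  rev≤hi x = ≤-trans (∸-monoʳ-≤ (lo x + hi x) (lo≤ x)) (≤-reflexive (m+n∸m≡n (lo x) (hi x)))

  lo≤rev : ∀ x → lo x ≤ rev x
  lo≤rev x = ≤-trans (≤-reflexive (sym (m+n∸n≡m (lo x) (hi x)))) (∸-monoʳ-≤ (lo x + hi x) (≤hi x))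

  rev-involutive : ∀ x → rev (rev x) ≡ x
  rev-involutive x = trans (cong₂ (λ l h → l + h ∸ rev x) (lo-unique {x} (lo≤rev x) (rev≤hi x)) (hi-unique {x} (lo≤rev x) (rev≤hi x)))
                           (m∸[m∸n]≡n (≤-trans (≤hi x) (m≤n+m (hi x) (lo x))))

  rev-injective : ∀ {x y} → rev x ≡ rev y → x ≡ y
  rev-injective {x} {y} e = trans (sym (rev-involutive x)) (trans (cong rev e) (rev-involutive y))

  rev-cut : ∀ {j x} → ¬ J j → x ≤ j → rev x ≤ j
  rev-cut {j} {x} ¬Jj x≤j = ≤-trans (rev≤hi x) (hi-least ¬Jj x≤j)

  rev-cut⁻ : ∀ {j x} → ¬ J j → rev x ≤ j → x ≤ j
  rev-cut⁻ {j} {x} ¬Jj le = subst (_≤ j) (rev-involutive x) (rev-cut ¬Jj le)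

  rev-anti : ∀ {x y} → lo x ≤ y → y < x → rev x < rev y
  rev-anti {x} {y} l y<x = subst (rev x <_) (cong₂ (λ l h → l + h ∸ y) (sym (lo-unique {x} l y≤h)) (sym (hi-unique {x} l y≤h)))
    (∸-monoʳ-< y<x (≤-trans (≤hi x) (m≤n+m (hi x) (lo x))))
    where y≤h = ≤-trans (<⇒≤ y<x) (≤hi x)

  rev-fix : ∀ {x} → ¬ J x → (∀ {j} → suc j ≡ x → ¬ J j) → rev x ≡ x
  rev-fix {x} ¬Jx ¬Jp = ≤-antisym (rev-cut ¬Jx ≤-refl) (go x refl)
    where
    go : ∀ z → z ≡ x → z ≤ rev x
    go zero _ = z≤n
    go (suc j) e = ≰⇒> λ le → <-irrefl refl (subst (_≤ j) (sym e) (rev-cut⁻ (¬Jp e) le))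

  -- `rev` keeps the order between different blocks and reverses it within a block. The cut, if
  -- there is one, is the upper end of the block of `v`.
  rev-inversion : ∀ {u v} → rev v < rev u → (∃[ j ] (¬ J j × v ≤ j × j < u)) ⊎ (lo v ≤ u × u < v)
  rev-inversion {u} {v} lt with hi v <? u
  ... | yes hi<u = inj₁ (hi v , hi-cut v , ≤hi v , hi<u)
  ... | no hi≮u with lo v ≤? u
  ...   | no lo≰u = contradiction lt (≤⇒≯ (<⇒≤ (<-≤-trans (below (lo v) refl (≰⇒> lo≰u)) (lo≤rev v))))
    where
    below : ∀ l → l ≡ lo v → u < l → rev u < l
    below (suc j) e u<l = s≤s (rev-cut (lo-cut v e) (s≤s⁻¹ u<l))
  ...   | yes lo≤u with u <? v
  ...     | yes u<v = inj₂ (lo≤u , u<v)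
  ...     | no u≮v with m≤n⇒m<n∨m≡n (≮⇒≥ u≮v)
  ...       | inj₂ refl = contradiction lt (<-irrefl refl)
  ...       | inj₁ v<u = contradiction lt (<-asym (rev-anti lo-u≤v v<u))
    where
    lo-u≤v : lo u ≤ v
    lo-u≤v = subst (_≤ v) (sym (lo-unique {v} lo≤u (≮⇒≥ hi≮u))) (lo≤ v)

-- Products of words in one-line notation

lookup-prod : ∀ n ws i → lookup (prod n ws) i ≡ act ws (suc (toℕ i))
lookup-prod n [] i = lookup∘tabulate (λ i → suc (toℕ i)) i
lookup-prod n (j ∷ ws) i = trans (lookup-map i (swapVal j) (prod n ws)) (cong (swapVal j) (lookup-prod n ws i))

lookup-ext : ∀ {n} {xs ys : Vec ℕ n} → (∀ i → lookup xs i ≡ lookup ys i) → xs ≡ ys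
lookup-ext {xs = xs} {ys} e = trans (sym (tabulate∘lookup xs)) (trans (tabulate-cong e) (tabulate∘lookup ys))

valid-fix-> : ∀ {n ws x} → ValidWord n ws → n < x → act ws x ≡ x
valid-fix-> valid n<x = act-fix (All.map (λ v → ≤-<-trans (proj₂ v) n<x) valid)

act-zero : ∀ {n ws} → ValidWord n ws → act ws 0 ≡ 0
act-zero [] = refl
act-zero {ws = i ∷ ws} ((1≤i , _) ∷ valid) =
  trans (cong (swapVal i) (act-zero valid)) (swapVal-other i (<⇒≢ 1≤i) 0≢1+n)

toPosition : ∀ {n x} → x < n → Σ (Fin n) λ i → toℕ i ≡ x
toPosition x<n = fromℕ< x<n , toℕ-fromℕ< x<n

expresses⇒act : ∀ {n us} {f : ℕ → ℕ} → ValidWord n us → f 0 ≡ 0 → (∀ {x} → n < x → f x ≡ x) →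
                (∀ (i : Fin n) → lookup (prod n us) i ≡ f (suc (toℕ i))) → ∀ x → act us x ≡ f x
expresses⇒act valid f0 fix e zero = trans (act-zero valid) (sym f0)
expresses⇒act {n} {us} {f} valid f0 fix e (suc x) with x <? n
... | no x≮n = trans (valid-fix-> valid (s≤s (≮⇒≥ x≮n))) (sym (fix (s≤s (≮⇒≥ x≮n))))
... | yes x<n with toPosition x<n
...   | i , refl = trans (sym (lookup-prod n us i)) (e i)

sameProd⇒sameAct : ∀ {n us ws} → ValidWord n us → ValidWord n ws → prod n us ≡ prod n ws → ∀ x → act us x ≡ act ws x
sameProd⇒sameAct {n} {us} {ws} vu vw e = expresses⇒act vu (act-zero vw) (valid-fix-> vw)
  (λ i → trans (cong (λ v → lookup v i) e) (lookup-prod n ws i))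

sameAct⇒sameProd : ∀ n us ws → (∀ x → act us x ≡ act ws x) → prod n us ≡ prod n ws
sameAct⇒sameProd n us ws e = lookup-ext λ i → trans (lookup-prod n us i) (trans (e _) (sym (lookup-prod n ws i)))

noRecross⇒reduced : ∀ {n ws w} → NoRecross ws → Expresses n ws w → Reduced n ws w
noRecross⇒reduced {ws = ws} nr (valid , e) = (valid , e) , λ ws' (valid' , e') →
  noRecross-minimal ws nr ws' (sameProd⇒sameAct valid' valid (trans e' (sym e)))

-- The longest element of a parabolic subgroup

noCrossOutside-all : ∀ {lo hi} ws → All (λ i → lo ≤ i × i ≤ hi) ws → ∀ p → NoCrossOutside lo hi ws p
noCrossOutside-all [] _ _ = tt
noCrossOutside-all (i ∷ ws) (∈ ∷ ∈s) p = (λ ∉ → contradiction ∈ ∉) , noCrossOutside-all ws ∈s p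

blockSize-top : ∀ {n a b} → b < n → blockSize n a b ≡ suc (suc b) ∸ a
blockSize-top {a = a} b<n = cong (λ m → suc m ∸ a) (m≥n⇒m⊓n≡n b<n)

pred< : ∀ {a} → 1 ≤ a → ¬ (a ≤ pred a)
pred< {suc a} _ = 1+n≰n

-- The element is `rev` for the letters from `a` to `b`. The inversions among its `b+2-a` moved
-- values bound every word for it from below, while insertion sort bounds the length of every
-- element of the parabolic subgroup from above by the same number.
longestElement : ∀ {n a b} → 1 ≤ a → a ≤ b → b < n →
                 ∃[ u ] (IsLongest n a b u × IsLength n u (tri (suc (suc b) ∸ a)))
longestElement {n} {a} {b} 1≤a a≤b b<n = prod n ws , (parabolic , longest) , (ws , (valid , refl) , length≡) , λ us → lower us
  where
  J : ℕ → Set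
  J i = a ≤ i × i ≤ b
  beyond : ∀ {j} → n ≤ j → ¬ J j
  beyond n≤j (_ , j≤b) = <⇒≱ b<n (≤-trans n≤j j≤b)
  open Blocks J (in? a b) n beyond
  open Sort J (in? a b)
  m : ℕ
  m = suc (suc b) ∸ a
  short : ∀ f → (∀ {x y} → f x ≡ f y → x ≡ y) → (∀ {x} → n < x → f x ≡ x) →
          (∀ {j x} → ¬ J j → f x ≤ j → x ≤ j) → ∃[ us ] (All J us × (∀ x → act us x ≡ f x) × length us ≤ tri m)
  short f inj fix cut with sortWord n f inj fix cut
  ... | us , js , same , count = us , js , same , subst₂ _≤_ (countIn-all us js) (cong tri (blockSize-top {a = a} b<n))
          (count a b (λ (le , _) → pred< 1≤a le) (λ (_ , le) → 1+n≰n le))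
  rev-word = short rev rev-injective
    (λ { (s≤s n≤x) → rev-fix (beyond (m≤n⇒m≤1+n n≤x)) (λ { refl → beyond n≤x }) }) rev-cut⁻
  ws = proj₁ rev-word
  ws-J = proj₁ (proj₂ rev-word)
  ws-rev = proj₁ (proj₂ (proj₂ rev-word))
  J⇒valid : ∀ {us} → All J us → ValidWord n us
  J⇒valid = All.map (λ (a≤i , i≤b) → ≤-trans 1≤a a≤i , ≤-<-trans i≤b b<n)
  valid : ValidWord n ws
  valid = J⇒valid ws-J
  parabolic : InParabolic n a b (prod n ws)
  parabolic = ws , ws-J , valid , refl
  lo-a : ∀ v → v < a + m → lo v ≤ a
  lo-a v v< = go (lo v) refl
    where
    go : ∀ l → l ≡ lo v → l ≤ a
    go zero _ = z≤n
    go (suc j) e = ≮⇒≥ λ a<l → lo-cut v e (s≤s⁻¹ a<l ,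
      s≤s⁻¹ (s≤s⁻¹ (≤-trans (s≤s (subst (_≤ v) (sym e) (lo≤ v)))
        (subst (v <_) (m+[n∸m]≡n (m≤n⇒m≤1+n (m≤n⇒m≤1+n a≤b))) v<))))
  inverted : AllPairs (λ x y → Inv rev (x , y)) (block rev a m)
  inverted = block-inversions a m rev-involutive
    (λ {u} {v} a≤u u<v v< → rev-anti (≤-trans (lo-a v v<) a≤u) u<v)
  lower : ∀ us → Expresses n us (prod n ws) → tri m ≤ length us
  lower us (valid' , e) = begin
    tri m                            ≡⟨ cong tri (sym (length-applyDownFrom (λ k → rev (a + k)) m)) ⟩
    tri (length (block rev a m))     ≡⟨ sym (length-pairs (block rev a m)) ⟩
    length (pairs (block rev a m))   ≤⟨ inversions≤countIn 0 n us _ (pairs-unique (inversions⇒unique {rev} inverted))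
                                          (pairs-all (AllPairs.map to-us inverted))
                                          (All.universal (noCrossOutside-all us (All.map (λ v → z≤n , <⇒≤ (proj₂ v)) valid')) _) ⟩
    countIn 0 n us                   ≤⟨ countIn≤length 0 n us ⟩
    length us                        ∎
    where
    open ≤-Reasoning
    us-rev : ∀ x → act us x ≡ rev x
    us-rev x = trans (sameProd⇒sameAct valid' valid e x) (ws-rev x)
    to-us : ∀ {x y} → Inv rev (x , y) → Inv (act us) (x , y)
    to-us (x<y , lt) = x<y , subst₂ _<_ (sym (us-rev _)) (sym (us-rev _)) lt
  length≡ : length ws ≡ tri m
  length≡ = ≤-antisym (proj₂ (proj₂ (proj₂ rev-word))) (lower ws (valid , refl))
  longest : ∀ v → InParabolic n a b v → ∀ lv lu → IsLength n v lv → IsLength n (prod n ws) lu → lv ≤ lu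
  longest v (vs , vs-J , vs-valid , vs-e) lv lu (_ , minimal) ((us , us-e , us-l) , _) =
    ≤-trans (minimal (proj₁ s) (J⇒valid (proj₁ (proj₂ s)) , trans (sameAct⇒sameProd n (proj₁ s) vs (proj₁ (proj₂ (proj₂ s)))) vs-e))
      (≤-trans (proj₂ (proj₂ (proj₂ s))) (≤-trans (lower us us-e) (≤-reflexive us-l)))
    where
    s = short (act vs) (act-injective vs) (valid-fix-> vs-valid)
          (λ ¬Jj → Low.act-reflects _ {vs} (All.map (λ ji e → ¬Jj (subst J e ji)) vs-J))

-- Products of distinct generators

Avoids321 Avoids3412 : (ℕ → ℕ) → Set
Avoids321 f = ∀ {x y z} → x < y → y < z → f y < f x → f z < f y → ⊥
Avoids3412 f = ∀ {x y z t} → x < y → y < z → z < t → f z < f t → f t < f x → f x < f y → ⊥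

inversion-bound : ∀ {f : ℕ → ℕ} {n} → (∀ {x y} → f x ≡ f y → x ≡ y) → (∀ {x} → n < x → f x ≡ x) →
                  ∀ {x y} → x < y → f y < f x → y ≤ n
inversion-bound {f} {n} inj fix {x} {y} x<y lt = ≮⇒≥ λ n<y →
  let y<fx = subst (_< f x) (fix n<y) lt
  in <-asym x<y (subst (y <_) (inj (fix (<-trans n<y y<fx))) y<fx)

-- Serves to remove a generator on the left, with `h = id`, or on the right, with `h` the swap.
-- Monotonicity up to `n` is enough, since no inversion of `g` reaches past `n`.
transfer-321 : ∀ {f g : ℕ → ℕ} {n} (h : ℕ → ℕ) → (∀ {x y} → g x ≡ g y → x ≡ y) → (∀ {x} → n < x → g x ≡ x) →
               (∀ {x y} → x < y → y ≤ n → h x < h y) → (∀ {x y} → x ≤ n → y ≤ n → g x < g y → f (h x) < f (h y)) →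
               Avoids321 f → Avoids321 g
transfer-321 h inj fix mono order av x<y y<z yx zy =
  av (mono x<y y≤) (mono y<z z≤) (order y≤ (<⇒≤ (<-≤-trans x<y y≤)) yx) (order z≤ y≤ zy)
  where
  z≤ = inversion-bound inj fix y<z zy
  y≤ = ≤-trans (<⇒≤ y<z) z≤

transfer-3412 : ∀ {f g : ℕ → ℕ} {n} (h : ℕ → ℕ) → (∀ {x y} → g x ≡ g y → x ≡ y) → (∀ {x} → n < x → g x ≡ x) →
               (∀ {x y} → x < y → y ≤ n → h x < h y) → (∀ {x y} → x ≤ n → y ≤ n → g x < g y → f (h x) < f (h y)) →
               Avoids3412 f → Avoids3412 g
transfer-3412 h inj fix mono order av x<y y<z z<t zt tx xy =
  av (mono x<y y≤) (mono y<z z≤) (mono z<t t≤) (order z≤ t≤ zt) (order t≤ x≤ tx) (order x≤ y≤ xy)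
  where
  t≤ = inversion-bound inj fix (<-trans y<z z<t) (<-trans tx xy)
  z≤ = ≤-trans (<⇒≤ z<t) t≤
  y≤ = ≤-trans (<⇒≤ y<z) z≤
  x≤ = ≤-trans (<⇒≤ x<y) y≤

-- Otherwise the value `n+1` sits at some `p < n` and position `n+1` holds a value below `n`. Let
-- `q` be the position of `n`. If `p < q`, then p, q, n+1 form 321; if `q < p`, then p, n, n+1 form
-- 321 or q, p, n, n+1 form 3412.
top-cases : ∀ n (v vi : ℕ → ℕ) → (∀ x → vi (v x) ≡ x) → (∀ x → v (vi x) ≡ x) → (∀ {x} → suc n < x → v x ≡ x) →
            Avoids321 v → Avoids3412 v → v (suc n) ≡ suc n ⊎ v (suc n) ≡ n ⊎ v n ≡ suc n
top-cases n v vi viv vvi fix no321 no3412 with v (suc n) ≟ suc n | v (suc n) ≟ n | v n ≟ suc n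
... | yes e | _ | _ = inj₁ e
... | no _ | yes e | _ = inj₂ (inj₁ e)
... | no _ | no _ | yes e = inj₂ (inj₂ e)
... | no k≢sn | no k≢n | no n≢ = ⊥-elim impossible
  where
  inj : ∀ {x y} → v x ≡ v y → x ≡ y
  inj {x} {y} e = trans (sym (viv x)) (trans (cong vi e) (viv y))
  bounded : ∀ {x} → x ≤ suc n → v x ≤ suc n
  bounded {x} le = ≮⇒≥ λ lt → <⇒≱ lt (subst (_≤ suc n) (sym (inj (fix lt))) le)
  bounded⁻ : ∀ {y} → y ≤ suc n → vi y ≤ suc n
  bounded⁻ {y} le = ≮⇒≥ λ lt → <⇒≱ lt (subst (_≤ suc n) (trans (sym (vvi y)) (fix lt)) le)
  p q : ℕ
  p = vi (suc n)
  q = vi n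
  p<n : p < n
  p<n = ≤∧≢⇒< (s≤s⁻¹ (≤∧≢⇒< (bounded⁻ ≤-refl) (λ e → k≢sn (trans (cong v (sym e)) (vvi (suc n))))))
              (λ e → n≢ (trans (cong v (sym e)) (vvi (suc n))))
  q<sn : q < suc n
  q<sn = ≤∧≢⇒< (bounded⁻ (n≤1+n n)) (λ e → k≢n (trans (cong v (sym e)) (vvi n)))
  k<n : v (suc n) < n
  k<n = ≤∧≢⇒< (s≤s⁻¹ (≤∧≢⇒< (bounded ≤-refl) k≢sn)) k≢n
  impossible : ⊥
  impossible with <-cmp p q | <-cmp (v n) (v (suc n))
  ... | tri≈ _ e _ | _ = 1+n≢n (trans (sym (vvi (suc n))) (trans (cong v e) (vvi n)))
  ... | tri< p<q _ _ | _ = no321 p<q q<sn (subst₂ _<_ (sym (vvi n)) (sym (vvi (suc n))) (n<1+n n)) (subst (v (suc n) <_) (sym (vvi n)) k<n)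
  ... | tri> _ _ q<p | tri< lt _ _ = no3412 q<p p<n (n<1+n n) lt (subst (v (suc n) <_) (sym (vvi n)) k<n)
                                       (subst₂ _<_ (sym (vvi n)) (sym (vvi (suc n))) (n<1+n n))
  ... | tri> _ _ q<p | tri≈ _ e _ = 1+n≢n (sym (inj e))
  ... | tri> _ _ q<p | tri> _ _ gt = no321 p<n (n<1+n n)
          (subst (v n <_) (sym (vvi (suc n))) (≤∧≢⇒< (bounded (n≤1+n n)) n≢)) gt

DistinctWord : ℕ → (ℕ → ℕ) → Set
DistinctWord n v = ∃[ ws ] (ValidWord n ws × (∀ j → countEq j ws ≤ 1) × (∀ x → act ws x ≡ v x))

fix-pred : ∀ {n} {f : ℕ → ℕ} → f (suc n) ≡ suc n → (∀ {x} → suc n < x → f x ≡ x) → ∀ {x} → n < x → f x ≡ x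
fix-pred {n} e fix {x} n<x with x ≟ suc n
... | yes refl = e
... | no ne = fix (≤∧≢⇒< n<x (ne ∘ sym))

valid-suc : ∀ {n ws} → ValidWord n ws → ValidWord (suc n) ws
valid-suc = All.map (λ (p , q) → p , m<n⇒m<1+n q)

countEq-fresh : ∀ {n ws} → ValidWord n ws → countEq n ws ≡ 0
countEq-fresh {ws = ws} valid = countEq-none ws (All.map (λ (_ , lt) → <⇒≢ lt) valid)

-- For `suc n`, remove `s_n` on the left if `v (n+1) = n` and on the right if `v n = n+1`. The rest
-- fixes `n+1`, so its word uses smaller letters only and `s_n` occurs once.
distinctWord : ∀ n (v vi : ℕ → ℕ) → (∀ x → vi (v x) ≡ x) → (∀ x → v (vi x) ≡ x) → v 0 ≡ 0 → (∀ {x} → n < x → v x ≡ x) →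
               Avoids321 v → Avoids3412 v → DistinctWord n v
distinctWord zero v vi viv vvi v0 fix _ _ = [] , [] , (λ _ → z≤n) , id≡v
  where
  id≡v : ∀ x → x ≡ v x
  id≡v zero = sym v0
  id≡v (suc x) = sym (fix (s≤s z≤n))
distinctWord (suc n) v vi viv vvi v0 fix no321 no3412 = cases (top-cases n v vi viv vvi fix no321 no3412)
  where
  inj : ∀ {x y} → v x ≡ v y → x ≡ y
  inj {x} {y} e = trans (sym (viv x)) (trans (cong vi e) (viv y))
  s : ℕ → ℕ
  s = swapVal n
  s-fix : ∀ {x} → suc n < x → s x ≡ x
  s-fix = swapVal-fix
  s-zero : 1 ≤ n → s 0 ≡ 0
  s-zero 1≤n = swapVal-other n (<⇒≢ 1≤n) 0≢1+n
  cases : v (suc n) ≡ suc n ⊎ v (suc n) ≡ n ⊎ v n ≡ suc n → DistinctWord (suc n) v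
  cases (inj₁ e) with distinctWord n v vi viv vvi v0 (fix-pred e fix) no321 no3412
  ... | ws , valid , count , same = ws , valid-suc valid , count , same
  cases (inj₂ (inj₁ e)) with distinctWord n v' vi' viv' vvi' v'0 v'-fix
      (transfer-321 id inj' v'-fix (λ lt _ → lt) order no321) (transfer-3412 id inj' v'-fix (λ lt _ → lt) order no3412)
    where
    v' vi' : ℕ → ℕ
    v' = s ∘ v
    vi' = vi ∘ s
    viv' : ∀ x → vi' (v' x) ≡ x
    viv' x = trans (cong vi (swapVal-involutive n (v x))) (viv x)
    vvi' : ∀ x → v' (vi' x) ≡ x
    vvi' x = trans (cong s (vvi (s x))) (swapVal-involutive n x)
    inj' : ∀ {x y} → v' x ≡ v' y → x ≡ y
    inj' = inj ∘ swapVal-injective n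
    v'0 : v' 0 ≡ 0
    -- `s` fixes 0 only for `n ≥ 1`; for `n = 0` this case would say `v 1 = 0 = v 0`.
    v'0 = trans (cong s v0) (s-zero (n≢0⇒n>0 λ { refl → 1+n≢0 (inj (trans e (sym v0))) }))
    v'-top : v' (suc n) ≡ suc n
    v'-top = trans (cong s e) (swapVal-here n)
    v'-fix : ∀ {x} → n < x → v' x ≡ x
    v'-fix = fix-pred v'-top (λ lt → trans (cong s (fix lt)) (s-fix lt))
    order : ∀ {x y} → x ≤ n → y ≤ n → v' x < v' y → v x < v y
    order {x} {y} _ y≤n lt = subst₂ _<_ (swapVal-involutive n (v x)) (swapVal-involutive n (v y))
      -- The exceptional pair would need `v' y = n+1`, but `v'` takes this value at `n+1 > y`.
      (swapVal-mono-< n lt (λ (_ , vy) → <⇒≱ (s≤s y≤n) (≤-reflexive (sym (inj' (trans vy (sym v'-top)))))))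
  ... | ws , valid , count , same = n ∷ ws , (1≤n , ≤-refl) ∷ valid-suc valid , count' ,
          λ x → trans (cong s (same x)) (swapVal-involutive n (v x))
    where
    1≤n : 1 ≤ n
    1≤n = n≢0⇒n>0 λ { refl → 1+n≢0 (inj (trans e (sym v0))) }
    count' : ∀ j → countEq j (n ∷ ws) ≤ 1
    count' j with n ≟ j
    ... | yes refl = ≤-reflexive (trans (countEq-here n ws) (cong suc (countEq-fresh valid)))
    ... | no ne = ≤-trans (≤-reflexive (countEq-skip ws ne)) (count j)
  cases (inj₂ (inj₂ e)) with distinctWord n v' vi' viv' vvi' v'0 v'-fix
      (transfer-321 s inj' v'-fix mono (λ _ _ lt → lt) no321) (transfer-3412 s inj' v'-fix mono (λ _ _ lt → lt) no3412)
    where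
    v' vi' : ℕ → ℕ
    v' = v ∘ s
    vi' = s ∘ vi
    viv' : ∀ x → vi' (v' x) ≡ x
    viv' x = trans (cong s (viv (s x))) (swapVal-involutive n x)
    vvi' : ∀ x → v' (vi' x) ≡ x
    vvi' x = trans (cong v (swapVal-involutive n (vi x))) (vvi x)
    inj' : ∀ {x y} → v' x ≡ v' y → x ≡ y
    inj' = swapVal-injective n ∘ inj
    v'0 : v' 0 ≡ 0
    v'0 = trans (cong v (s-zero (n≢0⇒n>0 λ { refl → 0≢1+n (trans (sym v0) e) }))) v0
    v'-fix : ∀ {x} → n < x → v' x ≡ x
    v'-fix = fix-pred (trans (cong v (swapVal-next n)) e) (λ lt → trans (cong v (s-fix lt)) (fix lt))
    mono : ∀ {x y} → x < y → y ≤ n → s x < s y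
    mono x<y y≤n = swapVal-mono-< n x<y (λ (_ , ey) → <⇒≱ (s≤s y≤n) (≤-reflexive (sym ey)))
  ... | ws , valid , count , same = ws ++ (n ∷ []) , All.++⁺ (valid-suc valid) ((1≤n , ≤-refl) ∷ []) , count' ,
          λ x → trans (act-++ ws (n ∷ []) x) (trans (same (s x)) (cong v (swapVal-involutive n x)))
    where
    1≤n : 1 ≤ n
    1≤n = n≢0⇒n>0 λ { refl → 0≢1+n (trans (sym v0) e) }
    count' : ∀ j → countEq j (ws ++ (n ∷ [])) ≤ 1
    count' j with n ≟ j
    ... | yes refl = ≤-reflexive (trans (countEq-++ n ws (n ∷ [])) (cong₂ _+_ (countEq-fresh valid) (countEq-here n [])))
    ... | no ne = ≤-trans (≤-reflexive (trans (countEq-++ j ws (n ∷ [])) (trans (cong (countEq j ws +_) (countEq-skip [] ne)) (+-identityʳ _)))) (count j)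

-- Permutations as functions on ℕ

extend : ∀ {n} → (Fin n → Fin n) → ℕ → ℕ
extend g zero = zero
extend {n} g (suc x) with x <? n
... | yes x<n = suc (toℕ (g (fromℕ< x<n)))
... | no _ = suc x

extend-suc : ∀ {n} (g : Fin n → Fin n) i → extend g (suc (toℕ i)) ≡ suc (toℕ (g i))
extend-suc {n} g i with toℕ i <? n
... | yes lt = cong (suc ∘ toℕ ∘ g) (fromℕ<-toℕ i lt)
... | no ≮ = contradiction (toℕ<n i) ≮

extend-fix : ∀ {n} (g : Fin n → Fin n) {x} → n < x → extend g x ≡ x
extend-fix {n} g {suc x} (s≤s n≤x) with x <? n
... | yes lt = contradiction lt (≤⇒≯ n≤x)
... | no _ = refl

extend-inverse : ∀ {n} (g h : Fin n → Fin n) → (∀ i → g (h i) ≡ i) → ∀ x → extend g (extend h x) ≡ x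
extend-inverse g h gh zero = refl
extend-inverse {n} g h gh (suc x) with x <? n
... | yes lt = trans (extend-suc g (h (fromℕ< lt))) (cong suc (trans (cong toℕ (gh (fromℕ< lt))) (toℕ-fromℕ< lt)))
... | no ≮ = extend-fix g (s≤s (≮⇒≥ ≮))

-- Descents of a permutation

module Perm (n : ℕ) (w wi : ℕ → ℕ) (wiw : ∀ x → wi (w x) ≡ x) (wwi : ∀ x → w (wi x) ≡ x)
            (w0 : w 0 ≡ 0) (fix : ∀ {x} → n < x → w x ≡ x) where

  J : ℕ → Set
  J j = wi (suc j) < wi j

  J? : Decidable J
  J? j = wi (suc j) <? wi j

  w-injective : ∀ {x y} → w x ≡ w y → x ≡ y
  w-injective {x} {y} e = trans (sym (wiw x)) (trans (cong wi e) (wiw y))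

  beyond : ∀ {j} → n ≤ j → ¬ J j
  beyond {j} n≤j lt = <-irrefl (trans (sym (wwi j)) (fix (≤-<-trans n≤j j<wij))) j<wij
    where
    j<wij : j < wi j
    j<wij = <-trans (n<1+n j) (subst (_< wi j) (trans (cong wi (sym (fix (s≤s n≤j)))) (wiw (suc j))) lt)

  J⇒1≤ : ∀ {j} → J j → 1 ≤ j
  J⇒1≤ {zero} lt = contradiction (subst (wi 1 <_) (trans (cong wi (sym w0)) (wiw 0)) lt) (λ ())
  J⇒1≤ {suc j} _ = s≤s z≤n

  J⇒< : ∀ {j} → J j → j < n
  J⇒< jj = ≰⇒> λ n≤j → beyond n≤j jj

  ¬J⇒< : ∀ {j} → ¬ J j → wi j < wi (suc j)
  ¬J⇒< {j} ¬jj = ≤∧≢⇒< (≮⇒≥ ¬jj) λ e → 1+n≢n (trans (sym (wwi (suc j))) (trans (cong w (sym e)) (wwi j)))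

  joined⇒decreasing : ∀ {u v} → (∀ {j} → u ≤ j → j < v → J j) → u < v → wi v < wi u
  joined⇒decreasing {u} {suc v} joined (s≤s u≤v) with m≤n⇒m<n∨m≡n u≤v
  ... | inj₂ refl = joined ≤-refl ≤-refl
  ... | inj₁ u<v = <-trans (joined u≤v ≤-refl) (joined⇒decreasing (λ le lt → joined le (m<n⇒m<1+n lt)) u<v)

  -- If all letters from `u` to `v-1` were descents, the positions would decrease from `u` to `v`.
  increasing⇒cut : ∀ {u v} → u < v → wi u < wi v → ∃[ j ] (¬ J j × u ≤ j × j < v)
  increasing⇒cut {u} {suc v} (s≤s u≤v) lt with J? v
  ... | no ¬jv = v , ¬jv , u≤v , ≤-refl
  ... | yes jv with m≤n⇒m<n∨m≡n u≤v
  ...   | inj₂ refl = contradiction lt (<-asym jv)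
  ...   | inj₁ u<v with increasing⇒cut u<v (<-trans lt jv)
  ...     | j , ¬jj , u≤j , j<v = j , ¬jj , u≤j , m<n⇒m<1+n j<v

  open Blocks J J? n beyond public
  open Sort J J? public

  -- Configurations excluded by the counting conditions

  module FromWord (ws : Word) (same : ∀ x → act ws x ≡ w x)
                  (s1 : ∀ j → ¬ J j → countEq j ws ≤ 1)
                  (s2 : ∀ {a b} → a ≤ b → (∀ {i} → a ≤ i → i ≤ b → J i) → ¬ J (pred a) → ¬ J (suc b) →
                        countIn a b ws ≤ tri (suc (suc b) ∸ a) + (suc b ∸ a)) where

    no-two-up : ∀ {x y j} → ¬ J j → x < y → y ≤ j → j < w x → j < w y → ⊥
    no-two-up {x} {y} {j} ¬jj x<y y≤j jx jy = <-irrefl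
      (Low.leave-once j (Low.exit j) ws (s1 j ¬jj) (≤-trans (<⇒≤ x<y) y≤j) y≤j
        (λ le → <⇒≱ jx (subst (_≤ j) (same x) le)) (λ le → <⇒≱ jy (subst (_≤ j) (same y) le))) x<y

    no-two-down : ∀ {x y j} → ¬ J j → x < y → j < x → w x ≤ j → w y ≤ j → ⊥
    no-two-down {x} {y} {j} ¬jj x<y j<x jx jy = <-irrefl
      (High.leave-once j (High.exit j) ws (s1 j ¬jj) j<x (<-trans j<x x<y)
        (λ lt → <⇒≱ lt (subst (_≤ j) (sym (same x)) jx)) (λ lt → <⇒≱ lt (subst (_≤ j) (sym (same y)) jy))) x<y

    -- If `y` starts at or below the cut, `x` and `y` both rise across it; otherwise `z` and `t`
    -- both fall across it.
    no-3412 : ∀ {x y z t j} → ¬ J j → x < y → y < z → z < t → w z ≤ j → w t ≤ j → j < w x → j < w y → ⊥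
    no-3412 {y = y} {j = j} ¬jj x<y y<z z<t wz wt wx wy with y ≤? j
    ... | yes y≤j = no-two-up ¬jj x<y y≤j wx wy
    ... | no y≰j = no-two-down ¬jj z<t (<-trans (≰⇒> y≰j) y<z) wz wt

    -- The values s+1,…,b+1 form the block of w y. Its strings, together with those of x and z,
    -- can only cross at the levels s,…,b+1, and they have too many inversions for S1 and S2.
    module Middle {x y z s b} (¬Js : ¬ J s) (¬Jb : ¬ J (suc b)) (joined : ∀ {j} → suc s ≤ j → j < suc b → J j)
                  (x<y : x < y) (y<z : y < z) (wz≤s : w z ≤ s) (s<wy : s < w y) (wy≤t : w y ≤ suc b) (t<wx : suc b < w x) where
      t m : ℕ
      t = suc b
      m = t ∸ s
      s≤b : s ≤ b
      s≤b = s≤s⁻¹ (<-≤-trans s<wy wy≤t)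
      s≤t : s ≤ t
      s≤t = m≤n⇒m≤1+n s≤b

      InBlock : ℕ → Set
      InBlock p = s < w p × w p ≤ t

      -- Meant for the strings of the block and those of `x` and `z`; each conjunct concerns only
      -- one of the cuts `s` and `t`.
      Strand : ℕ → Set
      Strand p = (p ≡ z ⊎ s < w p) × (p ≡ x ⊎ w p ≤ t)

      -- Otherwise `x` and `y` would both rise across `s`; dually, `y` starting above `t` would make
      -- `y` and `z` both fall across `t`.
      s<y : s < y
      s<y = ≰⇒> λ y≤s → no-two-up ¬Js x<y y≤s (≤-<-trans s≤t t<wx) s<wy
      y≤t : y ≤ t
      y≤t = ≮⇒≥ λ t<y → no-two-down ¬Jb y<z t<y wy≤t (≤-trans wz≤s s≤t)

      -- Two strands are never both at levels `≤ s`: only `z` ends there, and it starts above `s`,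
      -- so two strands starting there would both rise across `s`. Dually, they are never both above
      -- `t`, where only `x` ends.
      strands-confined : ∀ {p q} → p < q → Strand p → Strand q → NoCrossOutside s t ws (p , q)
      strands-confined {p} {q} p<q (low-p , high-p) (low-q , high-q) = noCrossOutside s t ws
        (Low.apart s ws (s1 s ¬Js) (start-low low-p low-q) (end-low low-p low-q))
        (High.apart t ws (s1 t ¬Jb) (start-high high-p high-q) (end-high high-p high-q))
        where
        start-low : p ≡ z ⊎ s < w p → q ≡ z ⊎ s < w q → ¬ (p ≤ s × q ≤ s)
        start-low (inj₁ refl) _ (le , _) = <⇒≱ (<-trans s<y y<z) le
        start-low (inj₂ _) (inj₁ refl) (_ , le) = <⇒≱ (<-trans s<y y<z) le
        start-low (inj₂ lp) (inj₂ lq) (_ , le) = no-two-up ¬Js p<q le lp lq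
        end-low : p ≡ z ⊎ s < w p → q ≡ z ⊎ s < w q → ¬ (act ws p ≤ s × act ws q ≤ s)
        end-low (inj₂ lp) _ (le , _) = <⇒≱ lp (subst (_≤ s) (same p) le)
        end-low (inj₁ _) (inj₂ lq) (_ , le) = <⇒≱ lq (subst (_≤ s) (same q) le)
        end-low (inj₁ refl) (inj₁ e) _ = <-irrefl (sym e) p<q
        start-high : p ≡ x ⊎ w p ≤ t → q ≡ x ⊎ w q ≤ t → ¬ (t < p × t < q)
        start-high (inj₁ refl) _ (lt , _) = <⇒≱ (<-trans lt x<y) y≤t
        start-high (inj₂ _) (inj₁ refl) (_ , lt) = <⇒≱ (<-trans lt x<y) y≤t
        start-high (inj₂ hp) (inj₂ hq) (lt , _) = no-two-down ¬Jb p<q lt hp hq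
        end-high : p ≡ x ⊎ w p ≤ t → q ≡ x ⊎ w q ≤ t → ¬ (t < act ws p × t < act ws q)
        end-high (inj₂ hp) _ (lt , _) = <⇒≱ (subst (t <_) (same p) lt) hp
        end-high (inj₁ _) (inj₂ hq) (_ , lt) = <⇒≱ (subst (t <_) (same q) lt) hq
        end-high (inj₁ refl) (inj₁ e) _ = <-irrefl (sym e) p<q

      strand-x : Strand x
      strand-x = inj₂ (≤-<-trans s≤t t<wx) , inj₁ refl
      strand-z : Strand z
      strand-z = inj₁ refl , inj₂ (≤-trans wz≤s s≤t)
      inBlock⇒strand : ∀ {p} → InBlock p → Strand p
      inBlock⇒strand (lt , le) = inj₂ lt , inj₂ le
      x∉ : ∀ {p} → InBlock p → p ≢ x
      x∉ (_ , le) refl = <⇒≱ t<wx le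
      z∉ : ∀ {p} → InBlock p → p ≢ z
      z∉ (lt , _) refl = <⇒≱ lt wz≤s

      -- Every string of the block crosses that of x or that of z; the one of y crosses both.
      choose : ℕ → ℕ × ℕ
      choose p with p <? z
      ... | yes _ = p , z
      ... | no _ = x , p

      choose-inverted : ∀ {p} → InBlock p → Inv w (choose p)
      choose-inverted {p} (lt , le) with p <? z
      ... | yes p<z = p<z , ≤-<-trans wz≤s lt
      ... | no p≮z = <-≤-trans (<-trans x<y y<z) (≮⇒≥ p≮z) , ≤-<-trans le t<wx
      choose-strands : ∀ {p} → InBlock p → Strand (proj₁ (choose p)) × Strand (proj₂ (choose p))
      choose-strands {p} ∈ with p <? z
      ... | yes _ = inBlock⇒strand ∈ , strand-z
      ... | no _ = strand-x , inBlock⇒strand ∈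
      choose-injective : ∀ {p q} → InBlock p → InBlock q → choose p ≡ choose q → p ≡ q
      choose-injective {p} {q} ∈p ∈q e with p <? z | q <? z
      ... | yes _ | yes _ = cong proj₁ e
      ... | yes _ | no _ = contradiction (sym (cong proj₂ e)) (z∉ ∈q)
      ... | no _ | yes _ = contradiction (cong proj₂ e) (z∉ ∈p)
      ... | no _ | no _ = cong proj₂ e
      choose≢xz : ∀ {p} → InBlock p → (x , z) ≢ choose p
      choose≢xz {p} ∈ e with p <? z
      ... | yes _ = x∉ ∈ (sym (cong proj₁ e))
      ... | no _ = z∉ ∈ (sym (cong proj₂ e))
      -- `choose` uses `x` only for strings starting at or after `z`, and `y < z`. So the crossing
      -- of `x` and `y` is a surplus one.
      choose≢xy : ∀ {p} → (x , y) ≢ choose p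
      choose≢xy {p} e with p <? z
      ... | yes _ = <-irrefl (cong proj₂ e) y<z
      ... | no p≮z = p≮z (subst (_< z) (cong proj₂ e) y<z)
      choose≢pair : ∀ {p q} → InBlock (proj₁ q) × InBlock (proj₂ q) → choose p ≢ q
      choose≢pair {p} (∈₁ , ∈₂) e with p <? z
      ... | yes _ = z∉ ∈₂ (sym (cong proj₂ e))
      ... | no _ = x∉ ∈₁ (sym (cong proj₁ e))

      inBlock : ∀ {k} → k < m → InBlock (wi (suc s + k))
      inBlock {k} k<m = subst (s <_) (sym (wwi _)) (s≤s (m≤m+n s k)) ,
        subst (_≤ t) (sym (wwi _)) (subst (s + k <_) (m+[n∸m]≡n s≤t) (+-monoʳ-< s k<m))

      strings : List ℕ
      strings = block wi (suc s) m
      chosen : List (ℕ × ℕ)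
      chosen = applyDownFrom (λ k → choose (wi (suc s + k))) m

      strings-inverted : AllPairs (λ p q → Inv w (p , q)) strings
      strings-inverted = block-inversions (suc s) m wwi λ {u} {v} s<u u<v v< →
        joined⇒decreasing (λ u≤j j<v → joined (≤-trans s<u u≤j)
          (<-≤-trans j<v (s≤s⁻¹ (subst (v <_) (cong suc (m+[n∸m]≡n s≤t)) v<)))) u<v
      strings-inBlock : All InBlock strings
      strings-inBlock = All.applyDownFrom⁺₁ _ m inBlock
      pairs-inBlock : All (λ p → InBlock (proj₁ p) × InBlock (proj₂ p)) (pairs strings)
      pairs-inBlock = pairs-elements strings-inBlock

      crossings : List (ℕ × ℕ)
      crossings = (x , z) ∷ (x , y) ∷ chosen ++ pairs strings

      crossings-unique : Unique crossings
      crossings-unique =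
        ((λ e → <-irrefl (sym (cong proj₂ e)) y<z) ∷ All.++⁺ (All.applyDownFrom⁺₁ _ m (choose≢xz ∘ inBlock)) (All.map x∉pair pairs-inBlock)) ∷
        All.++⁺ (All.applyDownFrom⁺₂ _ m (λ _ → choose≢xy)) (All.map x∉pair pairs-inBlock) ∷
        AllPairs.++⁺ (AllPairs.applyDownFrom⁺₁ _ m λ {i} {j} j<i i<m e → <-irrefl
                        (+-cancelˡ-≡ (suc s) j i (trans (sym (wwi _)) (trans (cong w (sym (choose-injective (inBlock i<m) (inBlock (<-trans j<i i<m)) e))) (wwi _)))) j<i)
                     (pairs-unique (inversions⇒unique {w} strings-inverted))
                     (All.applyDownFrom⁺₂ _ m (λ k → All.map choose≢pair pairs-inBlock))
        where
        x∉pair : ∀ {v q} → InBlock (proj₁ q) × InBlock (proj₂ q) → (x , v) ≢ q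
        x∉pair (∈ , _) e = x∉ ∈ (sym (cong proj₁ e))

      crossings-inverted : All (Inv w) crossings
      crossings-inverted = (<-trans x<y y<z , <-trans (≤-<-trans wz≤s s<wy) (≤-<-trans wy≤t t<wx)) ∷
        (x<y , ≤-<-trans wy≤t t<wx) ∷
        All.++⁺ (All.applyDownFrom⁺₁ _ m (choose-inverted ∘ inBlock)) (pairs-all {R = Inv w} strings-inverted)

      crossings-strands : All (λ p → Strand (proj₁ p) × Strand (proj₂ p)) crossings
      crossings-strands = (strand-x , strand-z) ∷ (strand-x , inBlock⇒strand (s<wy , wy≤t)) ∷
        All.++⁺ (All.applyDownFrom⁺₁ _ m (choose-strands ∘ inBlock))
                (All.map (λ (∈₁ , ∈₂) → inBlock⇒strand ∈₁ , inBlock⇒strand ∈₂) pairs-inBlock)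

      length-crossings : length crossings ≡ suc (suc (m + tri m))
      length-crossings = cong (suc ∘ suc) (trans (length-++ chosen) (cong₂ _+_ (length-applyDownFrom _ m)
        (trans (length-pairs strings) (cong tri (length-applyDownFrom _ m)))))

      many : suc (suc (m + tri m)) ≤ countIn s t ws
      many = subst (_≤ countIn s t ws) length-crossings (inversions≤countIn s t ws crossings crossings-unique
        (All.map (λ (lt , gt) → lt , subst₂ _<_ (sym (same _)) (sym (same _)) gt) crossings-inverted)
        (All.zipWith (λ ((lt , _) , st-p , st-q) → strands-confined lt st-p st-q) (crossings-inverted , crossings-strands)))

      inner : countIn (suc s) b ws ≤ tri m + (b ∸ s)
      inner with suc s ≤? b
      ... | yes s<b = s2 s<b (λ le le' → joined le (s≤s le')) ¬Js ¬Jb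
      -- A block of a single value has no letters of its own.
      ... | no s≮b = ≤-trans (≤-reflexive (countIn-none ws (All.universal (λ i (le , le') → s≮b (≤-trans le le')) ws))) z≤n

      few : countIn s t ws ≤ suc (suc (tri m + (b ∸ s)))
      few = begin
        countIn s t ws                                              ≤⟨ countIn-ends s b ws ⟩
        countEq s ws + (countIn (suc s) b ws + countEq t ws)        ≤⟨ +-mono-≤ (s1 s ¬Js) (+-mono-≤ inner (s1 t ¬Jb)) ⟩
        suc (tri m + (b ∸ s) + 1)                                   ≡⟨ cong suc (+-comm _ 1) ⟩
        suc (suc (tri m + (b ∸ s)))                                 ∎
        where open ≤-Reasoning

      absurd : ⊥
      -- `m` is `(b ∸ s) + 1`, so the bound `many` exceeds the bound `few` by one.
      absurd = <⇒≱ (subst (b ∸ s <_) (sym (+-∸-assoc 1 s≤b)) (n<1+n _))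
        (+-cancelʳ-≤ (tri m) m (b ∸ s) (subst (m + tri m ≤_) (+-comm (tri m) (b ∸ s)) (s≤s⁻¹ (s≤s⁻¹ (≤-trans many few)))))

    -- The cuts `j` and `k` lie outside the block of `w y`, so the ends of this block separate the
    -- three values too. These ends are generalised to variables in order to match them as
    -- successors.
    no-321 : ∀ {x y z j k} → ¬ J j → ¬ J k → x < y → y < z → w z ≤ k → k < w y → w y ≤ j → j < w x → ⊥
    no-321 {x} {y} {z} {j} {k} ¬jj ¬jk x<y y<z wz k< wy≤ j< = go (lo (w y)) refl (hi (w y)) refl
      where
      k<lo : k < lo (w y)
      k<lo = ≰⇒> λ lo≤k → ¬jk (lo-joined (w y) lo≤k k<)
      go : ∀ l → l ≡ lo (w y) → ∀ h → h ≡ hi (w y) → ⊥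
      go zero e _ _ = contradiction (subst (k <_) (sym e) k<lo) (λ ())
      go (suc s) e zero e' = contradiction (≤-trans (≤-<-trans z≤n k<) (subst (w y ≤_) (sym e') (≤hi (w y)))) (λ ())
      go (suc s) e (suc b) e' = Middle.absurd {s = s} {b}
        (lo-cut (w y) e) (subst (¬_ ∘ J) (sym e') (hi-cut (w y)))
        (λ {i} le lt → block-joined (w y) (subst (_≤ i) e le) (subst (i <_) e' lt))
        x<y y<z (≤-trans wz (s≤s⁻¹ (subst (k <_) (sym e) k<lo))) (subst (_≤ w y) (sym e) (lo≤ (w y)))
        (subst (w y ≤_) (sym e') (≤hi (w y))) (≤-<-trans (subst (_≤ j) (sym e') (hi-least ¬jj wy≤)) j<)

-- Pattern containment in terms of values and positions

-- An absent value gets the last place, which keeps the function total.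
indexOf : ∀ {k} → ℕ → Vec ℕ (suc k) → Fin (suc k)
indexOf v (_ ∷ []) = fzero
indexOf v (x ∷ p@(_ ∷ _)) with x ≟ v
... | yes _ = fzero
... | no _ = fsuc (indexOf v p)

-- A permutation of 1, ..., 5 that neither starts with 1 nor ends with 5. These two restrictions
-- force the positions of an occurrence in `w`, taken on all of ℕ, into the range from 1 to `n`.
IsPattern : Vec ℕ 5 → Set
IsPattern p = (∀ a → indexOf (lookup p a) p ≡ a × 1 ≤ lookup p a × lookup p a ≤ 5) ×
              1 < lookup p (# 0) × lookup p (# 4) < 5 × toℕ (indexOf 5 p) < 4

isPattern? : Decidable IsPattern
isPattern? p = Fin.all? (λ a → (indexOf (lookup p a) p Fin.≟ a) ×-dec (1 ≤? lookup p a) ×-dec (lookup p a ≤? 5)) ×-dec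
               (1 <? lookup p (# 0)) ×-dec (lookup p (# 4) <? 5) ×-dec (toℕ (indexOf 5 p) <? 4)

Chain : (ℕ → ℕ) → Set
Chain g = g 1 < g 2 × g 2 < g 3 × g 3 < g 4 × g 4 < g 5

chain-step : ∀ {g} → Chain g → ∀ i → 1 ≤ i → suc i ≤ 5 → g i < g (suc i)
chain-step (c , _) 1 _ _ = c
chain-step (_ , c , _) 2 _ _ = c
chain-step (_ , _ , c , _) 3 _ _ = c
chain-step (_ , _ , _ , c) 4 _ _ = c
chain-step _ (suc (suc (suc (suc (suc _))))) _ (s≤s (s≤s (s≤s (s≤s (s≤s ())))))

chain-mono : ∀ {g} → Chain g → ∀ i j → 1 ≤ i → i < j → j ≤ 5 → g i < g j
chain-mono {g} c i (suc j) 1≤i (s≤s i≤j) j<5 with m≤n⇒m<n∨m≡n i≤j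
... | inj₁ i<j = <-trans (chain-mono {g} c i j 1≤i i<j (<⇒≤ j<5)) (chain-step {g} c j (≤-trans 1≤i i≤j) j<5)
... | inj₂ refl = chain-step {g} c i 1≤i j<5

-- Lookup counted from 1, so that `Chain` applies to positions as well as to values.
at : Vec ℕ 5 → ℕ → ℕ
at xs k = lookup xs (indexOf k (1 ∷ 2 ∷ 3 ∷ 4 ∷ 5 ∷ []))

at-suc : ∀ xs a → at xs (suc (toℕ a)) ≡ lookup xs a
at-suc (_ ∷ _ ∷ _ ∷ _ ∷ _ ∷ []) fzero = refl
at-suc (_ ∷ _ ∷ _ ∷ _ ∷ _ ∷ []) (fsuc fzero) = refl
at-suc (_ ∷ _ ∷ _ ∷ _ ∷ _ ∷ []) (fsuc (fsuc fzero)) = refl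
at-suc (_ ∷ _ ∷ _ ∷ _ ∷ _ ∷ []) (fsuc (fsuc (fsuc fzero))) = refl
at-suc (_ ∷ _ ∷ _ ∷ _ ∷ _ ∷ []) (fsuc (fsuc (fsuc (fsuc fzero)))) = refl

-- Arguments are places in p: those of the entries forming the pattern 3412 or 321 (in the former up to the
-- order of each half), and of the ascents l, h separating their values.
Shape3412 : Vec ℕ 5 → (x y z t l h : Fin 5) → Set
Shape3412 p x y z t l h = x <ᶠ y × y <ᶠ z × z <ᶠ t × l <ᶠ h × lookup p l < lookup p h ×
  lookup p z ≤ lookup p l × lookup p t ≤ lookup p l × lookup p h ≤ lookup p x × lookup p h ≤ lookup p y

shape3412? : ∀ p x y z t l h → Dec (Shape3412 p x y z t l h)
shape3412? p x y z t l h = (x Fin.<? y) ×-dec (y Fin.<? z) ×-dec (z Fin.<? t) ×-dec (l Fin.<? h) ×-dec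
  (lookup p l <? lookup p h) ×-dec (lookup p z ≤? lookup p l) ×-dec (lookup p t ≤? lookup p l) ×-dec
  (lookup p h ≤? lookup p x) ×-dec (lookup p h ≤? lookup p y)

Shape321 : Vec ℕ 5 → (x y z l h l' h' : Fin 5) → Set
Shape321 p x y z l h l' h' = x <ᶠ y × y <ᶠ z × l <ᶠ h × l' <ᶠ h' ×
  lookup p l < lookup p h × lookup p l' < lookup p h' ×
  lookup p z ≤ lookup p l' × lookup p h' ≤ lookup p y × lookup p y ≤ lookup p l × lookup p h ≤ lookup p x

shape321? : ∀ p x y z l h l' h' → Dec (Shape321 p x y z l h l' h')
shape321? p x y z l h l' h' = (x Fin.<? y) ×-dec (y Fin.<? z) ×-dec (l Fin.<? h) ×-dec (l' Fin.<? h') ×-dec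
  (lookup p l <? lookup p h) ×-dec (lookup p l' <? lookup p h') ×-dec
  (lookup p z ≤? lookup p l') ×-dec (lookup p h' ≤? lookup p y) ×-dec
  (lookup p y ≤? lookup p l) ×-dec (lookup p h ≤? lookup p x)

module Spherical⇔Avoiding (n : ℕ) (σ : OneLine n) (w wi : ℕ → ℕ)
  (wiw : ∀ x → wi (w x) ≡ x) (wwi : ∀ x → w (wi x) ≡ x) (w0 : w 0 ≡ 0) (w-fix : ∀ {x} → n < x → w x ≡ x)
  (lookup-σ : ∀ i → lookup σ i ≡ w (suc (toℕ i))) where

  open Perm n w wi wiw wwi w0 w-fix

  toFin : ∀ {x} → 1 ≤ x → x ≤ n → Σ (Fin n) λ i → suc (toℕ i) ≡ x
  toFin {suc x} _ x<n = proj₁ (toPosition x<n) , cong suc (proj₂ (toPosition x<n))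

  InJ⇒J : ∀ {j} → InJ n σ j → J j
  InJ⇒J {j} (_ , _ , a , b , ea , eb , a<b) = subst₂ _<_ (position a ea) (position b eb) (s≤s a<b)
    where
    position : ∀ i {v} → lookup σ i ≡ v → suc (toℕ i) ≡ wi v
    position i e = trans (sym (wiw _)) (cong wi (trans (sym (lookup-σ i)) e))

  J⇒InJ : ∀ {j} → J j → InJ n σ j
  J⇒InJ {j} jj = J⇒1≤ jj , J⇒< jj , proj₁ a , proj₁ b , value (proj₁ a) (proj₂ a) , value (proj₁ b) (proj₂ b) ,
    s≤s⁻¹ (subst₂ _<_ (sym (proj₂ a)) (sym (proj₂ b)) jj)
    where
    position : ∀ {v} → 1 ≤ v → v ≤ n → Σ (Fin n) λ i → suc (toℕ i) ≡ wi v
    position {v} 1≤v v≤n = toFin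
      (n≢0⇒n>0 λ e → <⇒≢ 1≤v (trans (sym w0) (trans (cong w (sym e)) (wwi v))))
      (≮⇒≥ λ lt → <⇒≱ lt (subst (_≤ n) (trans (sym (wwi v)) (w-fix lt)) v≤n))
    a = position (s≤s z≤n) (J⇒< jj)
    b = position (J⇒1≤ jj) (<⇒≤ (J⇒< jj))
    value : ∀ i {v} → suc (toℕ i) ≡ wi v → lookup σ i ≡ v
    value i {v} e = trans (lookup-σ i) (trans (cong w e) (wwi v))

  -- Spherical permutations avoid the patterns

  module Containing {p : Vec ℕ 5} (c : Contains σ p) where
    pos : Fin 5 → ℕ
    pos a = suc (toℕ (proj₁ c a))

    pos-mono : ∀ {a b} → a <ᶠ b → pos a < pos b
    pos-mono {a} {b} lt = s≤s (proj₁ (proj₂ c) a b lt)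

    value-< : ∀ {a b} → lookup p a < lookup p b → w (pos a) < w (pos b)
    value-< {a} {b} lt = subst₂ _<_ (lookup-σ (proj₁ c a)) (lookup-σ (proj₁ c b))
      (Equivalence.from (proj₂ (proj₂ c) a b) lt)

    value-≤ : ∀ {a b} → lookup p a ≤ lookup p b → w (pos a) ≤ w (pos b)
    value-≤ {a} {b} le = ≮⇒≥ λ gt → <⇒≱ (Equivalence.to (proj₂ (proj₂ c) b a)
      (subst₂ _<_ (sym (lookup-σ (proj₁ c b))) (sym (lookup-σ (proj₁ c a))) gt)) le

    -- Positions decrease along a block, so values placed in increasing order lie in different
    -- blocks.
    cut : ∀ {l h} → l <ᶠ h → lookup p l < lookup p h → ∃[ j ] (¬ J j × w (pos l) ≤ j × j < w (pos h))
    cut {l} {h} l<h lt = increasing⇒cut (value-< lt) (subst₂ _<_ (sym (wiw (pos l))) (sym (wiw (pos h))) (pos-mono l<h))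

  module Avoiding {ws} (e : Expresses n ws σ) (s1 : S1 n σ ws) (s2 : S2 n σ ws) where

    same : ∀ x → act ws x ≡ w x
    same = expresses⇒act (proj₁ e) w0 w-fix
      (λ i → trans (cong (λ v → lookup v i) (proj₂ e)) (lookup-σ i))

    s1-total : ∀ j → ¬ J j → countEq j ws ≤ 1
    s1-total j ¬jj = cases (1 ≤? j) (j <? n)
      where
      cases : Dec (1 ≤ j) → Dec (j < n) → countEq j ws ≤ 1
      cases (yes 1≤j) (yes j<n) = s1 j 1≤j j<n (¬jj ∘ InJ⇒J)
      -- Outside the range covered by `S1`, a valid word has no letters at all.
      cases (no ≰) _ = ≤-trans (≤-reflexive (countEq-none ws (All.map (λ { (1≤i , _) refl → ≰ 1≤i }) (proj₁ e)))) z≤n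
      cases (yes _) (no ≮) = ≤-trans (≤-reflexive (countEq-none ws (All.map (λ { (_ , i<n) refl → ≮ i<n }) (proj₁ e)))) z≤n

    s2-tri : ∀ {a b} → a ≤ b → (∀ {i} → a ≤ i → i ≤ b → J i) → ¬ J (pred a) → ¬ J (suc b) →
          countIn a b ws ≤ tri (suc (suc b) ∸ a) + (suc b ∸ a)
    s2-tri {a} {b} a≤b js ¬ja ¬jb = bound (longestElement (J⇒1≤ (js ≤-refl a≤b)) a≤b (J⇒< (js a≤b ≤-refl)))
      where
      bound : ∃[ u ] (IsLongest n a b u × IsLength n u (tri (suc (suc b) ∸ a))) →
              countIn a b ws ≤ tri (suc (suc b) ∸ a) + (suc b ∸ a)
      bound (u , longest , len) = s2 a b (a≤b , (λ i le le' → J⇒InJ (js le le')) , ¬ja ∘ InJ⇒J , ¬jb ∘ InJ⇒J) u _ longest len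

    open FromWord ws same s1-total s2-tri

    -- The inequalities between entries of `p` are decided by evaluation; the ascent `l`, `h`
    -- supplies the cut between the two halves.
    avoid-3412 : ∀ p (x y z t l h : Fin 5) {_ : True (shape3412? p x y z t l h)} → Avoids σ p
    avoid-3412 p x y z t l h {ok} c = impossible (toWitness ok)
      where
      open Containing {p} c
      impossible : Shape3412 p x y z t l h → ⊥
      impossible (x<y , y<z , z<t , l<h , l<h' , z≤l , t≤l , h≤x , h≤y) with cut l<h l<h'
      ... | j , ¬jj , l≤j , j<h = no-3412 ¬jj (pos-mono x<y) (pos-mono y<z) (pos-mono z<t)
              (≤-trans (value-≤ z≤l) l≤j) (≤-trans (value-≤ t≤l) l≤j)
              (<-≤-trans j<h (value-≤ h≤x)) (<-≤-trans j<h (value-≤ h≤y))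

    avoid-321 : ∀ p (x y z l h l' h' : Fin 5) {_ : True (shape321? p x y z l h l' h')} → Avoids σ p
    avoid-321 p x y z l h l' h' {ok} c = impossible (toWitness ok)
      where
      open Containing {p} c
      impossible : Shape321 p x y z l h l' h' → ⊥
      impossible (x<y , y<z , l<h , l'<h' , lh , l'h' , z≤l' , h'≤y , y≤l , h≤x) with cut l<h lh | cut l'<h' l'h'
      ... | j , ¬jj , l≤j , j<h | k , ¬jk , l'≤k , k<h' =
        no-321 ¬jj ¬jk (pos-mono x<y) (pos-mono y<z) (≤-trans (value-≤ z≤l') l'≤k) (<-≤-trans k<h' (value-≤ h'≤y))
          (≤-trans (value-≤ y≤l) l≤j) (<-≤-trans j<h (value-≤ h≤x))

    avoids-all : All (Avoids σ) P
    avoids-all =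
      avoid-321 (2 ∷ 4 ∷ 5 ∷ 3 ∷ 1 ∷ []) (# 2) (# 3) (# 4) (# 1) (# 2) (# 0) (# 3) ∷
      avoid-321 (2 ∷ 5 ∷ 3 ∷ 1 ∷ 4 ∷ []) (# 1) (# 2) (# 3) (# 2) (# 4) (# 0) (# 2) ∷
      avoid-321 (2 ∷ 5 ∷ 3 ∷ 4 ∷ 1 ∷ []) (# 1) (# 2) (# 4) (# 2) (# 3) (# 0) (# 2) ∷
      avoid-3412 (3 ∷ 4 ∷ 5 ∷ 1 ∷ 2 ∷ []) (# 1) (# 2) (# 3) (# 4) (# 0) (# 1) ∷
      avoid-3412 (3 ∷ 4 ∷ 5 ∷ 2 ∷ 1 ∷ []) (# 1) (# 2) (# 3) (# 4) (# 0) (# 1) ∷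
      avoid-3412 (3 ∷ 5 ∷ 4 ∷ 1 ∷ 2 ∷ []) (# 1) (# 2) (# 3) (# 4) (# 0) (# 2) ∷
      avoid-3412 (3 ∷ 5 ∷ 4 ∷ 2 ∷ 1 ∷ []) (# 1) (# 2) (# 3) (# 4) (# 0) (# 2) ∷
      avoid-321 (4 ∷ 2 ∷ 5 ∷ 3 ∷ 1 ∷ []) (# 2) (# 3) (# 4) (# 0) (# 2) (# 1) (# 3) ∷
      avoid-3412 (4 ∷ 5 ∷ 1 ∷ 2 ∷ 3 ∷ []) (# 0) (# 1) (# 2) (# 3) (# 3) (# 4) ∷
      avoid-3412 (4 ∷ 5 ∷ 2 ∷ 1 ∷ 3 ∷ []) (# 0) (# 1) (# 2) (# 3) (# 2) (# 4) ∷
      avoid-3412 (4 ∷ 5 ∷ 2 ∷ 3 ∷ 1 ∷ []) (# 0) (# 1) (# 2) (# 4) (# 2) (# 3) ∷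
      avoid-321 (4 ∷ 5 ∷ 3 ∷ 1 ∷ 2 ∷ []) (# 1) (# 2) (# 3) (# 0) (# 1) (# 3) (# 4) ∷
      avoid-321 (5 ∷ 2 ∷ 3 ∷ 1 ∷ 4 ∷ []) (# 0) (# 2) (# 3) (# 2) (# 4) (# 1) (# 2) ∷
      avoid-321 (5 ∷ 2 ∷ 3 ∷ 4 ∷ 1 ∷ []) (# 0) (# 2) (# 4) (# 2) (# 3) (# 1) (# 2) ∷
      avoid-321 (5 ∷ 3 ∷ 1 ∷ 2 ∷ 4 ∷ []) (# 0) (# 1) (# 2) (# 1) (# 4) (# 2) (# 3) ∷
      avoid-321 (5 ∷ 3 ∷ 1 ∷ 4 ∷ 2 ∷ []) (# 0) (# 1) (# 2) (# 1) (# 3) (# 2) (# 4) ∷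
      avoid-3412 (5 ∷ 3 ∷ 4 ∷ 1 ∷ 2 ∷ []) (# 0) (# 2) (# 3) (# 4) (# 1) (# 2) ∷
      avoid-3412 (5 ∷ 3 ∷ 4 ∷ 2 ∷ 1 ∷ []) (# 0) (# 2) (# 3) (# 4) (# 1) (# 2) ∷
      avoid-3412 (5 ∷ 4 ∷ 1 ∷ 2 ∷ 3 ∷ []) (# 0) (# 1) (# 2) (# 3) (# 3) (# 4) ∷
      avoid-3412 (5 ∷ 4 ∷ 2 ∷ 1 ∷ 3 ∷ []) (# 0) (# 1) (# 2) (# 3) (# 2) (# 4) ∷
      avoid-3412 (5 ∷ 4 ∷ 2 ∷ 3 ∷ 1 ∷ []) (# 0) (# 1) (# 2) (# 4) (# 2) (# 3) ∷ []

  -- Permutations avoiding the patterns are spherical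

  module Constructing (avoids : All (Avoids σ) P) where

    -- `indexOf k p` picks from the positions `xs` the one whose value ranks `k`-th, so four
    -- inequalities of positions and four of values exhibit an occurrence.
    occurs : ∀ p {_ : True (p ∈? P)} {_ : True (isPattern? p)} (xs : Vec ℕ 5) →
             Chain (at xs) → Chain (λ k → w (lookup xs (indexOf k p))) → ⊥
    occurs p {p∈} {ok} xs increasing values = All.lookup avoids (toWitness p∈) (f , f-mono , λ a b → mk⇔ (to a b) (from a b))
      where
      isPat = toWitness ok
      index : ∀ a → indexOf (lookup p a) p ≡ a
      index a = proj₁ (proj₁ isPat a)
      xs-mono : ∀ {a b} → a <ᶠ b → lookup xs a < lookup xs b
      xs-mono {a} {b} lt = subst₂ _<_ (at-suc xs a) (at-suc xs b)
        (chain-mono {at xs} increasing (suc (toℕ a)) (suc (toℕ b)) (s≤s z≤n) (s≤s lt) (toℕ<n b))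
      val-mono : ∀ i j → 1 ≤ i → i < j → j ≤ 5 → w (lookup xs (indexOf i p)) < w (lookup xs (indexOf j p))
      val-mono = chain-mono {λ k → w (lookup xs (indexOf k p))} values
      w-mono : ∀ a b → lookup p a < lookup p b → w (lookup xs a) < w (lookup xs b)
      w-mono a b lt = subst₂ _<_ (cong (w ∘ lookup xs) (index a)) (cong (w ∘ lookup xs) (index b))
        (val-mono _ _ (proj₁ (proj₂ (proj₁ isPat a))) lt (proj₂ (proj₂ (proj₁ isPat b))))
      first-≥1 : 1 ≤ lookup xs (# 0)
      -- At position 0 the value is 0, but the first entry of `p` needs a smaller value elsewhere.
      first-≥1 = n≢0⇒n>0 λ e → contradiction (subst (w (lookup xs (indexOf 1 p)) <_) (trans (cong w e) w0)
        (subst (λ a → w (lookup xs (indexOf 1 p)) < w (lookup xs a)) (index (# 0))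
          (val-mono 1 _ ≤-refl (proj₁ (proj₂ isPat)) (proj₂ (proj₂ (proj₁ isPat (# 0))))))) n≮0
      last-≤n : lookup xs (# 4) ≤ n
      -- The entry 5 precedes the last entry, so the last position ends an inversion of `w`.
      last-≤n = inversion-bound w-injective w-fix (xs-mono (proj₂ (proj₂ (proj₂ isPat))))
        (subst (λ a → w (lookup xs a) < w (lookup xs (indexOf 5 p))) (index (# 4))
          (val-mono _ 5 (proj₁ (proj₂ (proj₁ isPat (# 4)))) (proj₁ (proj₂ (proj₂ isPat))) ≤-refl))
      xs-≥1 : ∀ a → 1 ≤ lookup xs a
      xs-≥1 fzero = first-≥1
      xs-≥1 (fsuc a) = ≤-trans first-≥1 (<⇒≤ (xs-mono (s≤s z≤n)))
      xs-≤n : ∀ a → lookup xs a ≤ n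
      xs-≤n a with m≤n⇒m<n∨m≡n (s≤s⁻¹ (toℕ<n a))
      ... | inj₁ lt = ≤-trans (<⇒≤ (xs-mono lt)) last-≤n
      ... | inj₂ e = subst (λ a → lookup xs a ≤ n) (sym (toℕ-injective {j = # 4} e)) last-≤n
      f : Fin 5 → Fin n
      f a = proj₁ (toFin (xs-≥1 a) (xs-≤n a))
      f-xs : ∀ a → suc (toℕ (f a)) ≡ lookup xs a
      f-xs a = proj₂ (toFin (xs-≥1 a) (xs-≤n a))
      f-mono : ∀ a b → a <ᶠ b → f a <ᶠ f b
      f-mono a b lt = s≤s⁻¹ (subst₂ _<_ (sym (f-xs a)) (sym (f-xs b)) (xs-mono lt))
      f-value : ∀ a → lookup σ (f a) ≡ w (lookup xs a)
      f-value a = trans (lookup-σ (f a)) (cong w (f-xs a))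
      from : ∀ a b → lookup p a < lookup p b → lookup σ (f a) < lookup σ (f b)
      from a b lt = subst₂ _<_ (sym (f-value a)) (sym (f-value b)) (w-mono a b lt)
      to : ∀ a b → lookup σ (f a) < lookup σ (f b) → lookup p a < lookup p b
      to a b lt with <-cmp (lookup p a) (lookup p b)
      ... | tri< lt' _ _ = lt'
      ... | tri≈ _ e _ = contradiction lt (<-irrefl (cong (lookup σ ∘ f) (trans (sym (index a)) (trans (cong (λ v → indexOf v p) e) (index b)))))
      ... | tri> _ _ gt = contradiction lt (<-asym (from b a gt))

    apart : ∀ {a b} → w a < w b → a < b ⊎ b < a
    apart {a} {b} lt with <-cmp a b
    ... | tri< a<b _ _ = inj₁ a<b
    ... | tri≈ _ refl _ = contradiction lt (<-irrefl refl)
    ... | tri> _ _ b<a = inj₂ b<a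

    -- The values `j` and `j+1` sit at positions `d < d'`, as `j` is no descent. Either `d` lies
    -- left of `y`, or `d'` lies right of `z`, or both lie strictly inside; `d = y` and `d' = z` are
    -- excluded by the values.
    between : ∀ {y z j} → ¬ J j → y < z → w z ≤ j → j < w y →
              (∃[ d ] (w z < w d × w d < w y × (d < y ⊎ z < d))) ⊎
              (∃[ d ] ∃[ d' ] (y < d × d < d' × d' < z × w z < w d × w d < w d' × w d' < w y))
    between {y} {z} {j} ¬jj y<z z≤j j<y = cases (<-cmp d y) (<-cmp d' z)
      where
      d d' : ℕ
      d = wi j
      d' = wi (suc j)
      wd : w d ≡ j
      wd = wwi j
      wd' : w d' ≡ suc j
      wd' = wwi (suc j)
      d<d' : d < d'
      d<d' = ¬J⇒< ¬jj
      z<d : z ≢ d → w z < w d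
      z<d ne = subst (w z <_) (sym wd) (≤∧≢⇒< z≤j (λ e → ne (trans (sym (wiw z)) (cong wi e))))
      d'<y : d' ≢ y → w d' < w y
      d'<y ne = subst (_< w y) (sym wd') (≤∧≢⇒< j<y (λ e → ne (trans (cong wi e) (wiw y))))
      cases : _ → _ → _
      cases (tri< d<y _ _) _ = inj₁ (d , z<d (λ { refl → <-asym y<z d<y }) , subst (_< w y) (sym wd) j<y , inj₁ d<y)
      cases (tri≈ _ d≡y _) _ = contradiction (trans (sym wd) (cong w d≡y)) (<⇒≢ j<y)
      cases (tri> _ _ y<d) (tri> _ _ z<d') = inj₁ (d' , subst (w z <_) (sym wd') (s≤s z≤j) ,
        d'<y (λ { refl → <-asym y<z z<d' }) , inj₂ z<d')
      cases (tri> _ _ y<d) (tri≈ _ d'≡z _) = contradiction (trans (sym wd') (cong w d'≡z)) (<⇒≢ (s≤s z≤j) ∘ sym)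
      cases (tri> _ _ y<d) (tri< d'<z _ _) = inj₂ (d , d' , y<d , d<d' , d'<z , z<d (λ { refl → <-asym d<d' d'<z }) ,
        subst₂ _<_ (sym wd) (sym wd') (n<1+n j) , d'<y (λ { refl → <-asym y<d d<d' }))

    -- An ascent inside either half of the 321 gives a pattern at once. Otherwise `e` separates the
    -- upper two values and `d` the lower two, each from outside its half, and their remaining
    -- positions select the pattern.
    no-321 : ∀ {x y z j k} → ¬ J j → ¬ J k → x < y → y < z → w z ≤ k → k < w y → w y ≤ j → j < w x → ⊥
    no-321 {x} {y} {z} ¬jj ¬jk x<y y<z wz k< wy j< with between ¬jj x<y wy j< | between ¬jk y<z wz k<
    ... | _ | inj₂ (d , d' , y<d , d<d' , d'<z , v₁ , v₂ , v₃) =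
          occurs (5 ∷ 4 ∷ 2 ∷ 3 ∷ 1 ∷ []) (x ∷ y ∷ d ∷ d' ∷ z ∷ []) (x<y , y<d , d<d' , d'<z) (v₁ , v₂ , v₃ , ≤-<-trans wy j<)
    ... | inj₂ (e , e' , x<e , e<e' , e'<y , v₁ , v₂ , v₃) | _ =
          occurs (5 ∷ 3 ∷ 4 ∷ 2 ∷ 1 ∷ []) (x ∷ e ∷ e' ∷ y ∷ z ∷ []) (x<e , e<e' , e'<y , y<z) (≤-<-trans wz k< , v₁ , v₂ , v₃)
    ... | inj₁ (e , y<e , e<x , e-pos) | inj₁ (d , z<d , d<y , d-pos) = cases e-pos d-pos
      where
      vals : w z < w d × w d < w y × w y < w e × w e < w x
      vals = z<d , d<y , y<e , e<x
      cases : e < x ⊎ y < e → d < y ⊎ z < d → ⊥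
      cases (inj₁ e<x) (inj₁ d<y') with apart (<-trans d<y (<-trans y<e (proj₂ (proj₂ (proj₂ vals)))))
      ... | inj₂ x<d = occurs (4 ∷ 5 ∷ 2 ∷ 3 ∷ 1 ∷ []) (e ∷ x ∷ d ∷ y ∷ z ∷ []) (e<x , x<d , d<y' , y<z) vals
      ... | inj₁ d<x with apart (<-trans d<y y<e)
      ...   | inj₁ d<e = occurs (2 ∷ 4 ∷ 5 ∷ 3 ∷ 1 ∷ []) (d ∷ e ∷ x ∷ y ∷ z ∷ []) (d<e , e<x , x<y , y<z) vals
      ...   | inj₂ e<d = occurs (4 ∷ 2 ∷ 5 ∷ 3 ∷ 1 ∷ []) (e ∷ d ∷ x ∷ y ∷ z ∷ []) (e<d , d<x , x<y , y<z) vals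
      cases (inj₁ e<x) (inj₂ z<d') = occurs (4 ∷ 5 ∷ 3 ∷ 1 ∷ 2 ∷ []) (e ∷ x ∷ y ∷ z ∷ d ∷ []) (e<x , x<y , y<z , z<d') vals
      cases (inj₂ y<e') (inj₁ d<y') with apart (<-trans d<y (<-trans y<e e<x)) | apart (<-trans (<-trans z<d d<y) y<e)
      ... | inj₁ d<x | inj₁ z<e = occurs (2 ∷ 5 ∷ 3 ∷ 1 ∷ 4 ∷ []) (d ∷ x ∷ y ∷ z ∷ e ∷ []) (d<x , x<y , y<z , z<e) vals
      ... | inj₁ d<x | inj₂ e<z = occurs (2 ∷ 5 ∷ 3 ∷ 4 ∷ 1 ∷ []) (d ∷ x ∷ y ∷ e ∷ z ∷ []) (d<x , x<y , y<e' , e<z) vals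
      ... | inj₂ x<d | inj₁ z<e = occurs (5 ∷ 2 ∷ 3 ∷ 1 ∷ 4 ∷ []) (x ∷ d ∷ y ∷ z ∷ e ∷ []) (x<d , d<y' , y<z , z<e) vals
      ... | inj₂ x<d | inj₂ e<z = occurs (5 ∷ 2 ∷ 3 ∷ 4 ∷ 1 ∷ []) (x ∷ d ∷ y ∷ e ∷ z ∷ []) (x<d , d<y' , y<e' , e<z) vals
      cases (inj₂ y<e') (inj₂ z<d') with apart (<-trans (<-trans z<d d<y) y<e)
      ... | inj₂ e<z = occurs (5 ∷ 3 ∷ 4 ∷ 1 ∷ 2 ∷ []) (x ∷ y ∷ e ∷ z ∷ d ∷ []) (x<y , y<e' , e<z , z<d') vals
      ... | inj₁ z<e with apart (<-trans d<y y<e)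
      ...   | inj₁ d<e = occurs (5 ∷ 3 ∷ 1 ∷ 2 ∷ 4 ∷ []) (x ∷ y ∷ z ∷ d ∷ e ∷ []) (x<y , y<z , z<d' , d<e) vals
      ...   | inj₂ e<d = occurs (5 ∷ 3 ∷ 1 ∷ 4 ∷ 2 ∷ []) (x ∷ y ∷ z ∷ e ∷ d ∷ []) (x<y , y<z , z<e , e<d) vals

    -- `between` is applied to the smaller of the two upper values and the larger of the two lower
    -- ones, so that a separator it finds lies between all four in value.
    no-3412 : ∀ {x y z t j} → ¬ J j → x < y → y < z → z < t → w z ≤ j → w t ≤ j → j < w x → j < w y → ⊥
    no-3412 {x} {y} {z} {t} ¬jj x<y y<z z<t wz wt wx wy with ordered x<y | ordered z<t
      where
      ordered : ∀ {a b} → a < b → w a < w b ⊎ w b < w a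
      ordered {a} {b} a<b with <-cmp (w a) (w b)
      ... | tri< lt _ _ = inj₁ lt
      ... | tri≈ _ e _ = contradiction (w-injective e) (<⇒≢ a<b)
      ... | tri> _ _ gt = inj₂ gt
    ... | inj₁ wx<wy | inj₁ wz<wt with between ¬jj (<-trans x<y (<-trans y<z z<t)) wt wx
    ...   | inj₁ (e , v₁ , v₂ , inj₁ e<x) = occurs (3 ∷ 4 ∷ 5 ∷ 1 ∷ 2 ∷ []) (e ∷ x ∷ y ∷ z ∷ t ∷ []) (e<x , x<y , y<z , z<t) (wz<wt , v₁ , v₂ , wx<wy)
    ...   | inj₁ (e , v₁ , v₂ , inj₂ t<e) = occurs (4 ∷ 5 ∷ 1 ∷ 2 ∷ 3 ∷ []) (x ∷ y ∷ z ∷ t ∷ e ∷ []) (x<y , y<z , z<t , t<e) (wz<wt , v₁ , v₂ , wx<wy)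
    ...   | inj₂ (e , e' , x<e , e<e' , e'<t , v₁ , v₂ , v₃) with apart (<-trans v₂ (<-trans v₃ wx<wy)) | apart (<-trans wz<wt (<-trans v₁ v₂))
    ...     | inj₂ y<e | _ = occurs (4 ∷ 5 ∷ 2 ∷ 3 ∷ 1 ∷ []) (x ∷ y ∷ e ∷ e' ∷ t ∷ []) (x<y , y<e , e<e' , e'<t) (v₁ , v₂ , v₃ , wx<wy)
    ...     | inj₁ e<y | inj₂ e'<z = occurs (5 ∷ 3 ∷ 4 ∷ 1 ∷ 2 ∷ []) (x ∷ e ∷ e' ∷ z ∷ t ∷ []) (x<e , e<e' , e'<z , z<t) (wz<wt , v₁ , v₂ , v₃)
    ...     | inj₁ e<y | inj₁ z<e' = occurs (5 ∷ 3 ∷ 1 ∷ 4 ∷ 2 ∷ []) (x ∷ e ∷ z ∷ e' ∷ t ∷ []) (x<e , <-trans e<y y<z , z<e' , e'<t) (wz<wt , v₁ , v₂ , v₃)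
    no-3412 {x} {y} {z} {t} ¬jj x<y y<z z<t wz wt wx wy | inj₁ wx<wy | inj₂ wt<wz with between ¬jj (<-trans x<y y<z) wz wx
    ...   | inj₁ (e , v₁ , v₂ , inj₁ e<x) = occurs (3 ∷ 4 ∷ 5 ∷ 2 ∷ 1 ∷ []) (e ∷ x ∷ y ∷ z ∷ t ∷ []) (e<x , x<y , y<z , z<t) (wt<wz , v₁ , v₂ , wx<wy)
    ...   | inj₂ (e , e' , x<e , e<e' , e'<z , v₁ , v₂ , v₃) = occurs (5 ∷ 3 ∷ 4 ∷ 2 ∷ 1 ∷ []) (x ∷ e ∷ e' ∷ z ∷ t ∷ []) (x<e , e<e' , e'<z , z<t) (wt<wz , v₁ , v₂ , v₃)
    ...   | inj₁ (e , v₁ , v₂ , inj₂ z<e) with apart (<-trans wt<wz v₁)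
    ...     | inj₁ t<e = occurs (4 ∷ 5 ∷ 2 ∷ 1 ∷ 3 ∷ []) (x ∷ y ∷ z ∷ t ∷ e ∷ []) (x<y , y<z , z<t , t<e) (wt<wz , v₁ , v₂ , wx<wy)
    ...     | inj₂ e<t = occurs (4 ∷ 5 ∷ 2 ∷ 3 ∷ 1 ∷ []) (x ∷ y ∷ z ∷ e ∷ t ∷ []) (x<y , y<z , z<e , e<t) (wt<wz , v₁ , v₂ , wx<wy)
    no-3412 {x} {y} {z} {t} ¬jj x<y y<z z<t wz wt wx wy | inj₂ wy<wx | inj₁ wz<wt with between ¬jj (<-trans y<z z<t) wt wy
    ...   | inj₁ (e , v₁ , v₂ , inj₂ t<e) = occurs (5 ∷ 4 ∷ 1 ∷ 2 ∷ 3 ∷ []) (x ∷ y ∷ z ∷ t ∷ e ∷ []) (x<y , y<z , z<t , t<e) (wz<wt , v₁ , v₂ , wy<wx)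
    ...   | inj₂ (e , e' , y<e , e<e' , e'<t , v₁ , v₂ , v₃) = occurs (5 ∷ 4 ∷ 2 ∷ 3 ∷ 1 ∷ []) (x ∷ y ∷ e ∷ e' ∷ t ∷ []) (x<y , y<e , e<e' , e'<t) (v₁ , v₂ , v₃ , wy<wx)
    ...   | inj₁ (e , v₁ , v₂ , inj₁ e<y) with apart (<-trans v₂ wy<wx)
    ...     | inj₁ e<x = occurs (3 ∷ 5 ∷ 4 ∷ 1 ∷ 2 ∷ []) (e ∷ x ∷ y ∷ z ∷ t ∷ []) (e<x , x<y , y<z , z<t) (wz<wt , v₁ , v₂ , wy<wx)
    ...     | inj₂ x<e = occurs (5 ∷ 3 ∷ 4 ∷ 1 ∷ 2 ∷ []) (x ∷ e ∷ y ∷ z ∷ t ∷ []) (x<e , e<y , y<z , z<t) (wz<wt , v₁ , v₂ , wy<wx)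
    no-3412 {x} {y} {z} {t} ¬jj x<y y<z z<t wz wt wx wy | inj₂ wy<wx | inj₂ wt<wz with between ¬jj y<z wz wy
    ...   | inj₂ (e , e' , y<e , e<e' , e'<z , v₁ , v₂ , v₃) = occurs (5 ∷ 4 ∷ 2 ∷ 3 ∷ 1 ∷ []) (x ∷ y ∷ e ∷ e' ∷ z ∷ []) (x<y , y<e , e<e' , e'<z) (v₁ , v₂ , v₃ , wy<wx)
    ...   | inj₁ (e , v₁ , v₂ , inj₁ e<y) with apart (<-trans v₂ wy<wx)
    ...     | inj₁ e<x = occurs (3 ∷ 5 ∷ 4 ∷ 2 ∷ 1 ∷ []) (e ∷ x ∷ y ∷ z ∷ t ∷ []) (e<x , x<y , y<z , z<t) (wt<wz , v₁ , v₂ , wy<wx)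
    ...     | inj₂ x<e = occurs (5 ∷ 3 ∷ 4 ∷ 2 ∷ 1 ∷ []) (x ∷ e ∷ y ∷ z ∷ t ∷ []) (x<e , e<y , y<z , z<t) (wt<wz , v₁ , v₂ , wy<wx)
    no-3412 {x} {y} {z} {t} ¬jj x<y y<z z<t wz wt wx wy | inj₂ wy<wx | inj₂ wt<wz | inj₁ (e , v₁ , v₂ , inj₂ z<e) with apart (<-trans wt<wz v₁)
    ...     | inj₁ t<e = occurs (5 ∷ 4 ∷ 2 ∷ 1 ∷ 3 ∷ []) (x ∷ y ∷ z ∷ t ∷ e ∷ []) (x<y , y<z , z<t , t<e) (wt<wz , v₁ , v₂ , wy<wx)
    ...     | inj₂ e<t = occurs (5 ∷ 4 ∷ 2 ∷ 3 ∷ 1 ∷ []) (x ∷ y ∷ z ∷ e ∷ t ∷ []) (x<y , y<z , z<e , e<t) (wt<wz , v₁ , v₂ , wy<wx)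

    v vi : ℕ → ℕ
    v = rev ∘ w
    vi = wi ∘ rev

    -- Besides a cut, `rev-inversion` leaves only values `w x < w y` in one block; there positions
    -- decrease, against `x < y`.
    v-inversion : ∀ {x y} → x < y → v y < v x → ∃[ j ] (¬ J j × w y ≤ j × j < w x)
    v-inversion {x} {y} x<y lt with rev-inversion lt
    ... | inj₁ cut = cut
    ... | inj₂ (lo≤ , wx<wy) = contradiction x<y (<-asym (subst₂ _<_ (wiw y) (wiw x)
            (joined⇒decreasing (λ le lt → lo-joined (w y) (≤-trans lo≤ le) lt) wx<wy)))

    v-321 : Avoids321 v
    v-321 x<y y<z yx zy with v-inversion x<y yx | v-inversion y<z zy
    ... | j , ¬jj , wy≤j , j<wx | k , ¬jk , wz≤k , k<wy = no-321 ¬jj ¬jk x<y y<z wz≤k k<wy wy≤j j<wx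

    -- The outer inversion `x`, `t` gives the cut. As `rev` respects cuts, `v z < v t` and
    -- `v x < v y` put `w z` on the side of `w t` and `w y` on the side of `w x`.
    v-3412 : Avoids3412 v
    v-3412 {x} {y} {z} {t} x<y y<z z<t zt tx xy with v-inversion (<-trans x<y (<-trans y<z z<t)) tx
    ... | j , ¬jj , wt≤j , j<wx = no-3412 ¬jj x<y y<z z<t
          (rev-cut⁻ ¬jj (≤-trans (<⇒≤ zt) (rev-cut ¬jj wt≤j))) wt≤j j<wx
          (≰⇒> λ wy≤j → <⇒≱ j<wx (rev-cut⁻ ¬jj (≤-trans (<⇒≤ xy) (rev-cut ¬jj wy≤j))))

    rev-fix-> : ∀ {x} → n < x → rev x ≡ x
    rev-fix-> (s≤s n≤x) = rev-fix (beyond (m≤n⇒m≤1+n n≤x)) (λ { refl → beyond n≤x })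

    assemble : SortedWord n rev → DistinctWord n v → Spherical n σ
    assemble (us , us-J , us-rev , us-count) (vs , vs-valid , vs-count , vs-v) with reduce (us ++ vs)
    ... | ws , sub , nr , same = ws , noRecross⇒reduced nr (valid , ws-w) , s1 , s2
      where
      valid : ValidWord n ws
      valid = All-resp-⊆ sub (All.++⁺ (All.map (λ j → J⇒1≤ j , J⇒< j) us-J) vs-valid)
      ws-w : prod n ws ≡ σ
      ws-w = lookup-ext λ i → trans (lookup-prod n ws i) (trans (same _) (trans (act-++ us vs _)
        (trans (us-rev _) (trans (cong rev (vs-v _)) (trans (rev-involutive _) (sym (lookup-σ i)))))))
      s1 : S1 n σ ws
      s1 j _ _ ¬InJ = begin
        countEq j ws                     ≤⟨ countEq-⊆ j sub ⟩
        countEq j (us ++ vs)             ≡⟨ countEq-++ j us vs ⟩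
        countEq j us + countEq j vs      ≡⟨ cong (_+ countEq j vs) (countEq-none us (All.map (λ { jj refl → ¬InJ (J⇒InJ jj) }) us-J)) ⟩
        countEq j vs                     ≤⟨ vs-count j ⟩
        1                                ∎
        where open ≤-Reasoning
      s2 : S2 n σ ws
      s2 a b (a≤b , js , ¬ja , ¬jb) u lu longest len = begin
        countIn a b ws                       ≤⟨ countIn-⊆ a b sub ⟩
        countIn a b (us ++ vs)               ≡⟨ countIn-++ a b us vs ⟩
        countIn a b us + countIn a b vs      ≤⟨ +-mono-≤ (≤-trans (us-count a b (¬ja ∘ J⇒InJ) (¬jb ∘ J⇒InJ)) (≤-reflexive (cong tri (blockSize-top {a = a} b<n))))
                                                         (countIn-distinct (suc b ∸ a) vs vs-count (m≤n+m∸n (suc b) a)) ⟩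
        tri (suc (suc b) ∸ a) + (suc b ∸ a)  ≤⟨ +-monoˡ-≤ (suc b ∸ a) tri≤lu ⟩
        lu + (suc b ∸ a)                     ∎
        where
        open ≤-Reasoning
        b<n : b < n
        b<n = J⇒< (InJ⇒J (js b a≤b ≤-refl))
        tri≤lu : tri (suc (suc b) ∸ a) ≤ lu
        -- `S2` ranges over every longest `u`, so its length is compared with that of the element
        -- constructed above.
        tri≤lu = bound (longestElement (J⇒1≤ (InJ⇒J (js a ≤-refl a≤b))) a≤b b<n)
          where
          bound : ∃[ u' ] (IsLongest n a b u' × IsLength n u' (tri (suc (suc b) ∸ a))) → tri (suc (suc b) ∸ a) ≤ lu
          bound (u' , (parabolic , _) , len') = proj₂ longest u' parabolic _ _ len' len

    spherical : Spherical n σ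
    spherical = assemble
      (sortWord n rev rev-injective rev-fix-> rev-cut⁻)
      (distinctWord n v vi (λ x → trans (cong wi (rev-involutive (w x))) (wiw x))
        (λ x → trans (cong rev (wwi (rev x))) (rev-involutive x))
        (trans (cong rev w0) (rev-fix (n≮0 ∘ J⇒1≤) (λ ()))) (λ lt → trans (cong rev (w-fix lt)) (rev-fix-> lt)) v-321 v-3412)

theorem1p5 : (n : ℕ) → 1 ≤ n → (π : Permutation′ n) →
    Spherical n (oneLine π) ⇔ All (λ p → Avoids (oneLine π) p) P
theorem1p5 n _ π = mk⇔
  (λ (ws , (e , _) , s1 , s2) → Avoiding.avoids-all {ws} e s1 s2)
  Constructing.spherical
  where
  open Spherical⇔Avoiding n (oneLine π) (extend (π ⟨$⟩ʳ_)) (extend (π ⟨$⟩ˡ_))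
    (extend-inverse (π ⟨$⟩ˡ_) (π ⟨$⟩ʳ_) (λ _ → inverseˡ π))
    (extend-inverse (π ⟨$⟩ʳ_) (π ⟨$⟩ˡ_) (λ _ → inverseʳ π))
    refl (extend-fix (π ⟨$⟩ʳ_))
    (λ i → trans (lookup∘tabulate _ i) (sym (extend-suc (π ⟨$⟩ʳ_) i)))
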